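{- We have $N(H)\gg H^{3/2}$; that is, there is an absolute constant $c>0$ such that $N(H)\ge cH^{3/2}$ for all sufficiently large $H$.
   Context: For a large positive real number $H$, $N(H)$ denotes the number of monic quintic polynomials $f(X)=X^5+aX^4+bX^3+cX^2+dX+e$ with $a,b,c,d,e\in\mathbb{Z}\cap[-H,H]$ that are irreducible (over $\mathbb{Q}$) and solvable by radicals (equivalently, whose Galois group over $\mathbb{Q}$ is solvable). -}

module Defs where

open import Algebra.Apartness.Bundles using (HeytingField)
open import Algebra.Bundles using (CommutativeRing)
open import Algebra.Bundles.Raw using (RawRing; RawSemiring)
import Algebra.Definitions.RawSemiring as SemiringDefinitions
open import Algebra.Morphism.Structures using (module RingMorphisms)
open import Data.Fin.Base using (Fin)
open import Data.Integer.Base using (ℤ; +_)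
open import Data.List.Base using (List; []; _∷_; _++_; map; foldr)
open import Data.List.Relation.Unary.All using (All)
open import Data.Nat.Base as ℕ using (ℕ; zero; suc)
open import Data.Product.Base using (Σ-syntax; ∃-syntax; _×_)
open import Data.Rational.Base as ℚ using (ℚ; 1ℚ)
open import Data.Vec.Base using (Vec; []; _∷_)
open import Data.Vec.Relation.Unary.All as Vec using ()
open import Function.Definitions using (Injective)
open import Level using (Level; 0ℓ; _⊔_) renaming (suc to lsuc)
open import Relation.Binary.PropositionalEquality using (_≡_)
open import Relation.Unary using (Pred)

------------------------------------------------------------------------
-- Univariate polynomials

-- A polynomial is its list of coefficients, constant term first.  Trailing
-- zeros are allowed, so polynomials are compared coefficientwise by _≈ᴾ_.

module Polynomial {c ℓ : Level} (R : RawRing c ℓ) where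
  open RawRing R

  Poly : Set c
  Poly = List Carrier

  coeff : Poly → ℕ → Carrier
  coeff []      _       = 0#
  coeff (a ∷ p) zero    = a
  coeff (a ∷ p) (suc n) = coeff p n

  infix 4 _≈ᴾ_
  _≈ᴾ_ : Poly → Poly → Set ℓ
  p ≈ᴾ q = ∀ n → coeff p n ≈ coeff q n

  infixl 6 _+ᴾ_
  _+ᴾ_ : Poly → Poly → Poly
  []      +ᴾ q       = q
  (a ∷ p) +ᴾ []      = a ∷ p
  (a ∷ p) +ᴾ (b ∷ q) = (a + b) ∷ (p +ᴾ q)

  infixl 7 _*ᴾ_
  _*ᴾ_ : Poly → Poly → Poly
  []      *ᴾ q = []
  (a ∷ p) *ᴾ q = map (a *_) q +ᴾ (0# ∷ (p *ᴾ q))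

  polyRawSemiring : RawSemiring c ℓ
  polyRawSemiring = record
    { Carrier = Poly
    ; _≈_     = _≈ᴾ_
    ; _+_     = _+ᴾ_
    ; _*_     = _*ᴾ_
    ; 0#      = []
    ; 1#      = 1# ∷ []
    }

  eval : Poly → Carrier → Carrier
  eval p x = foldr (λ a r → a + x * r) 0# p

  X-_ : Carrier → Poly
  X- x = (- x) ∷ 1# ∷ []

------------------------------------------------------------------------
-- Algebraically closed extension fields of ℚ

record AlgebraicallyClosedExtension : Set (lsuc 0ℓ) where
  field
    heytingField : HeytingField 0ℓ 0ℓ 0ℓ

  open HeytingField heytingField public

  commutativeRing : CommutativeRing 0ℓ 0ℓ
  commutativeRing = record { isCommutativeRing = isCommutativeRing }

  rawRing : RawRing 0ℓ 0ℓ
  rawRing = CommutativeRing.rawRing commutativeRing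

  open Polynomial rawRing public
  open RingMorphisms ℚ.+-*-rawRing rawRing public using (IsRingHomomorphism)

  field
    ι      : ℚ → Carrier
    ι-homo : IsRingHomomorphism ι

    -- Every monic polynomial of positive degree has a root.
    closed : ∀ a as → ∃[ x ] eval (a ∷ as ++ 1# ∷ []) x ≈ 0#

------------------------------------------------------------------------
-- Solvability by radicals

-- Intermediate fields of Ω/ℚ are represented as predicates on Ω.

module Radicals (Ω : AlgebraicallyClosedExtension) where
  open AlgebraicallyClosedExtension Ω
  open SemiringDefinitions (RawRing.rawSemiring rawRing) using (_^_)

  Rationals : Pred Carrier 0ℓ
  Rationals x = ∃[ q ] ι q ≈ x

  -- K ⟨ α ⟩ is the smallest subfield containing K and α.
  data _⟨_⟩ (K : Pred Carrier 0ℓ) (α : Carrier) : Pred Carrier 0ℓ where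
    base : ∀ {x} → K x → (K ⟨ α ⟩) x
    gen  : (K ⟨ α ⟩) α
    add  : ∀ {x y} → (K ⟨ α ⟩) x → (K ⟨ α ⟩) y → (K ⟨ α ⟩) (x + y)
    mul  : ∀ {x y} → (K ⟨ α ⟩) x → (K ⟨ α ⟩) y → (K ⟨ α ⟩) (x * y)
    neg  : ∀ {x} → (K ⟨ α ⟩) x → (K ⟨ α ⟩) (- x)
    inv  : ∀ {x y} → x * y ≈ 1# → (K ⟨ α ⟩) x → (K ⟨ α ⟩) y
    resp : ∀ {x y} → x ≈ y → (K ⟨ α ⟩) x → (K ⟨ α ⟩) y

  data RadicalExtension : Pred Carrier 0ℓ → Set (lsuc 0ℓ) where
    rationals : RadicalExtension Rationals
    adjoin    : ∀ {K} → RadicalExtension K →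
                ∀ α n → .{{ℕ.NonZero n}} → K (α ^ n) →
                RadicalExtension (K ⟨ α ⟩)

  -- f = c (X - x₁) ⋯ (X - xₘ) with c, x₁, …, xₘ in K.
  SplitsOver : Pred Carrier 0ℓ → Poly → Set
  SplitsOver K f =
    ∃[ c ] ∃[ xs ] All K (c ∷ xs) ×
                   (f ≈ᴾ foldr (λ x g → (X- x) *ᴾ g) (c ∷ []) xs)

module ℚ[X] = Polynomial ℚ.+-*-rawRing

-- f splits over a radical extension of ℚ.  The extension is sought inside an
-- algebraically closed field Ω containing ℚ, in which every radical extension
-- of ℚ embeds; the answer is the same for all Ω (e.g. Ω = ℂ or an algebraic
-- closure of ℚ), since only the elements of Ω algebraic over ℚ matter.
-- Quantifying over Ω thus avoids fixing a construction of one such field.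
SolvableByRadicals : ℚ[X].Poly → Set (lsuc 0ℓ)
SolvableByRadicals f =
  (Ω : AlgebraicallyClosedExtension) →
  Σ[ K ∈ Pred (Ω .Carrier) 0ℓ ]
    RadicalExtension Ω K × SplitsOver Ω K (map (Ω .ι) f)
  where
  open AlgebraicallyClosedExtension using (Carrier; ι)
  open Radicals using (RadicalExtension; SplitsOver)

-- Irreducibility in the ring ℚ[X]; the units there are the nonzero constants.
Irreducible : ℚ[X].Poly → Set
Irreducible = SemiringDefinitions.Irreducible ℚ[X].polyRawSemiring

------------------------------------------------------------------------
-- The counting function

fromℤ : ℤ → ℚ
fromℤ i = i ℚ./ 1

-- (a, b, c, d, e) ↦ X⁵ + aX⁴ + bX³ + cX² + dX + e
quintic : Vec ℤ 5 → ℚ[X].Poly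
quintic (a ∷ b ∷ c ∷ d ∷ e ∷ []) =
  fromℤ e ∷ fromℤ d ∷ fromℤ c ∷ fromℤ b ∷ fromℤ a ∷ 1ℚ ∷ []

_∈[-_,+] : ℤ → ℚ → Set
i ∈[- H ,+] = ((ℚ.- H) ℚ.≤ fromℤ i) × (fromℤ i ℚ.≤ H)

-- The set whose cardinality is N(H).  The height H ranges over ℚ: the set only
-- depends on ⌊H⌋, and every real H is at most some rational with the same floor,
-- so lower bounds increasing in H are the same for rational and for real H.
SolvableQuintics : ℚ → Pred (Vec ℤ 5) (lsuc 0ℓ)
SolvableQuintics H v =
  Vec.All (_∈[- H ,+]) v ×
  Irreducible (quintic v) ×
  SolvableByRadicals (quintic v)

-- The set P has at least n elements.
infix 4 _≤∣_∣
_≤∣_∣ : ∀ {a p} {A : Set a} → ℕ → Pred A p → Set (a ⊔ p)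
_≤∣_∣ {A = A} n P =
  Σ[ f ∈ (Fin n → A) ] Injective _≡_ _≡_ f × (∀ i → P (f i))

-- For c, H ≥ 0, squaring both sides gives c · H^(3/2) ≤ n.
_·_^3/2≤_ : ℚ → ℚ → ℕ → Set
c · H ^3/2≤ n = (c ℚ.* c) ℚ.* (H ℚ.* H ℚ.* H) ℚ.≤ fromℤ (+ n) ℚ.* fromℤ (+ n)

{-# OPTIONS --safe #-}

-- The quintics X⁵ - 5aX³ + 5a²X + e, with e = 25k + 5, are shifted Dickson polynomials.
-- They are Eisenstein at 5, and since (u + v)⁵ - 5uv(u + v)³ + 5(uv)²(u + v) = u⁵ + v⁵,
-- their roots are ζⁱu + ζ⁻ⁱv, where ζ⁵ = 1, uv = a and u⁵, v⁵ are the roots of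
-- W² + eW + a⁵.  If 25m² ≤ H, there are m³ of them with 1 ≤ a ≤ m and 0 ≤ k < m².

module Submission where

open import Defs
open import Data.Nat.Base using (ℕ)
open import Data.Product.Base using (∃-syntax; _×_)
open import Data.Rational.Base using (ℚ; 0ℚ; _<_; _≤_)

open import Algebra.Bundles using (CommutativeRing)
open import Algebra.Bundles.Raw using (RawRing)
open import Algebra.Definitions.RawMagma using (_,_)
import Algebra.Definitions.RawSemiring as SemiringDefinitions
import Algebra.Properties.CommutativeSemigroup as CommutativeSemigroupProperties
import Algebra.Properties.Ring as RingProperties
import Algebra.Solver.Ring as RingSolver
open import Algebra.Solver.Ring.AlmostCommutativeRing using (fromCommutativeRing; _-Raw-AlmostCommutative⟶_)
open import Data.Fin.Base using (Fin; toℕ; remQuot; combine)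
import Data.Fin.Properties as Fin
open import Data.Integer.Base as ℤ using (ℤ; +_; 0ℤ; 1ℤ; +≤+; +<+; -≤+)
open import Data.Integer.Divisibility.Signed using (_∣_; divides; _∣?_; ∣ᵤ⇒∣; ∣⇒∣ᵤ; ∣m∣n⇒∣m+n; ∣m+n∣m⇒∣n; ∣m+n∣n⇒∣m; ∣n⇒∣m*n; ∣m⇒∣m*n)
import Data.Integer.Properties as ℤ
open import Data.List.Base using (List; []; _∷_; map; foldr)
open import Data.List.Relation.Unary.All using ([]; _∷_)
open import Data.Maybe.Base as Maybe using ()
open import Data.Nat.Base as ℕ using (zero; suc; z≤n; s≤s; z<s; s<s)
import Data.Nat.Coprimality as Coprimality
import Data.Nat.Divisibility as ℕ
open import Data.Nat.Induction using (<-rec)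
open import Data.Nat.Primality using (Prime; prime?; euclidsLemma; prime⇒nonZero; prime⇒nonTrivial)
import Data.Nat.Properties as ℕ
import Data.Nat.Solver as ℕ
open import Data.Product.Base using (_,_; proj₁; proj₂)
open import Data.Rational.Base as ℚ using (mkℚ; 1ℚ; *≤*; *<*)
import Data.Rational.Properties as ℚ
import Data.Rational.Solver as ℚ
import Data.Rational.Unnormalised.Base as ℚᵘ
import Data.Rational.Unnormalised.Properties as ℚᵘ
open import Data.Sum.Base as Sum using (_⊎_; inj₁; inj₂; [_,_]′; map₁; map₂)
open import Data.Vec.Base using (Vec; []; _∷_)
open import Data.Vec.Relation.Unary.All as Vec using ([]; _∷_)
open import Function.Base using (_∘_; case_of_)
open import Function.Definitions using (Injective)
open import Level using (0ℓ)
open import Relation.Binary.Definitions using (tri<; tri≈; tri>)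
open import Relation.Binary.PropositionalEquality as ≡ using (_≡_; _≢_; refl; cong; cong₂; subst)
open import Relation.Nullary using (¬_; yes; no; contradiction)
open import Relation.Nullary.Decidable using (decidable-stable; dec⇒maybe; from-yes; from-no)
open import Relation.Unary using (Pred)

-- The exponent is 1/2 + 1: the coefficient `5a²` confines `a` to the order of √H, while `e` runs
-- through a residue class modulo 25 up to the order of H.
--
-- Irreducibility is asked over ℚ, whereas Eisenstein's argument lives over ℤ. Clearing denominators
-- in each factor turns f = gh into N F = P Q with an integer N ≠ 0. Gauss's lemma and Eisenstein's
-- criterion are then proved together by descent on |N|; only the prime p is ever cancelled from N,
-- the rest of N does no harm.
--
-- Solvability is asked in every Ω, a Heyting field: equality there is not decidable, and `closed`
-- is the only source of roots. So nothing may depend on whether `u` vanishes, and each step is a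
-- polynomial identity, possibly modulo Φ₅(ζ) = 0 or a consequence of it. The only divisions are by
-- the rationals 2 and `a`. To keep the identities small, the four roots other than u + v are
-- grouped into two pairs, whose quadratics have coefficients in ζ + ζ⁴, u + v and uv.

-- Coefficients of products of polynomials over a commutative ring

module PolynomialProperties {c ℓ} (R : CommutativeRing c ℓ) where
  open CommutativeRing R renaming (refl to ≈-refl; sym to ≈-sym; trans to ≈-trans)
  open Polynomial rawRing public
  open import Relation.Binary.Reasoning.Setoid setoid
  open CommutativeSemigroupProperties *-commutativeSemigroup using (x∙yz≈y∙xz)

  coeff-+ᴾ : ∀ p q n → coeff (p +ᴾ q) n ≈ coeff p n + coeff q n
  coeff-+ᴾ []      q       n       = ≈-sym (+-identityˡ _)
  coeff-+ᴾ (a ∷ p) []      n       = ≈-sym (+-identityʳ _)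
  coeff-+ᴾ (a ∷ p) (b ∷ q) zero    = ≈-refl
  coeff-+ᴾ (a ∷ p) (b ∷ q) (suc n) = coeff-+ᴾ p q n

  coeff-scale : ∀ a p n → coeff (map (a *_) p) n ≈ a * coeff p n
  coeff-scale a []      n       = ≈-sym (zeroʳ a)
  coeff-scale a (b ∷ p) zero    = ≈-refl
  coeff-scale a (b ∷ p) (suc n) = coeff-scale a p n

  coeff-*ᴾ-zero : ∀ a p q → coeff ((a ∷ p) *ᴾ q) 0 ≈ a * coeff q 0
  coeff-*ᴾ-zero a p q = begin
    coeff (map (a *_) q +ᴾ _) 0   ≈⟨ coeff-+ᴾ (map (a *_) q) _ 0 ⟩
    coeff (map (a *_) q) 0 + 0#   ≈⟨ +-identityʳ _ ⟩
    coeff (map (a *_) q) 0        ≈⟨ coeff-scale a q 0 ⟩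
    a * coeff q 0                 ∎

  coeff-*ᴾ-suc : ∀ a p q n →
                 coeff ((a ∷ p) *ᴾ q) (suc n) ≈ a * coeff q (suc n) + coeff (p *ᴾ q) n
  coeff-*ᴾ-suc a p q n =
    ≈-trans (coeff-+ᴾ (map (a *_) q) _ (suc n)) (+-congʳ (coeff-scale a q (suc n)))

  coeff₀-*ᴾ : ∀ p q → coeff (p *ᴾ q) 0 ≈ coeff p 0 * coeff q 0
  coeff₀-*ᴾ []      q = ≈-sym (zeroˡ _)
  coeff₀-*ᴾ (a ∷ p) q = coeff-*ᴾ-zero a p q

  -- Polynomials are compared coefficientwise, so `p` and `p′` may be lists of different lengths.
  -- The induction therefore runs over both lists, and either may end first.
  *ᴾ-scale : ∀ a b p p′ q q′ → (∀ n → coeff p′ n ≈ a * coeff p n) →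
             (∀ n → coeff q′ n ≈ b * coeff q n) →
             ∀ n → coeff (p′ *ᴾ q′) n ≈ (a * b) * coeff (p *ᴾ q) n
  *ᴾ-scale a b p p′ q q′ hp hq = go p p′ hp
    where
    lead : ∀ {c c′} → c′ ≈ a * c → ∀ n → c′ * coeff q′ n ≈ (a * b) * (c * coeff q n)
    lead {c} {c′} h n = begin
      c′ * coeff q′ n            ≈⟨ *-cong h (hq n) ⟩
      (a * c) * (b * coeff q n)  ≈⟨ *-assoc _ _ _ ⟩
      a * (c * (b * coeff q n))  ≈⟨ *-congˡ (x∙yz≈y∙xz _ _ _) ⟩
      a * (b * (c * coeff q n))  ≈⟨ *-assoc _ _ _ ⟨
      (a * b) * (c * coeff q n)  ∎

    -- The case where the unscaled list has ended; `c * 0#` is the form in which `go` then holds its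
    -- hypothesis.
    vanish : ∀ c p → (∀ n → coeff p n ≈ c * 0#) → ∀ n → coeff (p *ᴾ q′) n ≈ 0#
    vanish c []      h n       = ≈-refl
    vanish c (x ∷ p) h zero    = begin
      coeff ((x ∷ p) *ᴾ q′) 0 ≈⟨ coeff-*ᴾ-zero x p q′ ⟩
      x * coeff q′ 0          ≈⟨ *-congʳ (≈-trans (h 0) (zeroʳ c)) ⟩
      0# * coeff q′ 0         ≈⟨ zeroˡ _ ⟩
      0#                      ∎
    vanish c (x ∷ p) h (suc n) = begin
      coeff ((x ∷ p) *ᴾ q′) (suc n)               ≈⟨ coeff-*ᴾ-suc x p q′ n ⟩
      x * coeff q′ (suc n) + coeff (p *ᴾ q′) n    ≈⟨ +-cong (*-congʳ (≈-trans (h 0) (zeroʳ c))) (vanish c p (h ∘ suc) n) ⟩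
      0# * coeff q′ (suc n) + 0#                  ≈⟨ +-identityʳ _ ⟩
      0# * coeff q′ (suc n)                       ≈⟨ zeroˡ _ ⟩
      0#                                          ∎

    go : ∀ p p′ → (∀ n → coeff p′ n ≈ a * coeff p n) →
         ∀ n → coeff (p′ *ᴾ q′) n ≈ (a * b) * coeff (p *ᴾ q) n
    go []      p′       h n       = ≈-trans (vanish a p′ h n) (≈-sym (zeroʳ _))
    go (x ∷ p) []       h zero    = begin
      0#                                ≈⟨ zeroˡ _ ⟨
      0# * coeff q′ 0                   ≈⟨ lead (h 0) 0 ⟩
      (a * b) * (x * coeff q 0)         ≈⟨ *-congˡ (coeff-*ᴾ-zero x p q) ⟨
      (a * b) * coeff ((x ∷ p) *ᴾ q) 0  ∎
    go (x ∷ p) []       h (suc n) = begin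
      0#                                                            ≈⟨ +-identityʳ _ ⟨
      0# + 0#                                                       ≈⟨ +-congʳ (zeroˡ _) ⟨
      0# * coeff q′ (suc n) + 0#                                    ≈⟨ +-cong (lead (h 0) (suc n)) (go p [] (h ∘ suc) n) ⟩
      (a * b) * (x * coeff q (suc n)) + (a * b) * coeff (p *ᴾ q) n  ≈⟨ distribˡ _ _ _ ⟨
      (a * b) * (x * coeff q (suc n) + coeff (p *ᴾ q) n)            ≈⟨ *-congˡ (coeff-*ᴾ-suc x p q n) ⟨
      (a * b) * coeff ((x ∷ p) *ᴾ q) (suc n)                        ∎
    go (x ∷ p) (x′ ∷ p′) h zero    = begin
      coeff ((x′ ∷ p′) *ᴾ q′) 0         ≈⟨ coeff-*ᴾ-zero x′ p′ q′ ⟩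
      x′ * coeff q′ 0                   ≈⟨ lead (h 0) 0 ⟩
      (a * b) * (x * coeff q 0)         ≈⟨ *-congˡ (coeff-*ᴾ-zero x p q) ⟨
      (a * b) * coeff ((x ∷ p) *ᴾ q) 0  ∎
    go (x ∷ p) (x′ ∷ p′) h (suc n) = begin
      coeff ((x′ ∷ p′) *ᴾ q′) (suc n)                               ≈⟨ coeff-*ᴾ-suc x′ p′ q′ n ⟩
      x′ * coeff q′ (suc n) + coeff (p′ *ᴾ q′) n                    ≈⟨ +-cong (lead (h 0) (suc n)) (go p p′ (h ∘ suc) n) ⟩
      (a * b) * (x * coeff q (suc n)) + (a * b) * coeff (p *ᴾ q) n  ≈⟨ distribˡ _ _ _ ⟨
      (a * b) * (x * coeff q (suc n) + coeff (p *ᴾ q) n)            ≈⟨ *-congˡ (coeff-*ᴾ-suc x p q n) ⟨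
      (a * b) * coeff ((x ∷ p) *ᴾ q) (suc n)                        ∎

  *ᴾ-scaleˡ : ∀ a p p′ q → (∀ n → coeff p′ n ≈ a * coeff p n) →
              ∀ n → coeff (p′ *ᴾ q) n ≈ a * coeff (p *ᴾ q) n
  *ᴾ-scaleˡ a p p′ q h n =
    ≈-trans (*ᴾ-scale a 1# p p′ q q h (λ _ → ≈-sym (*-identityˡ _)) n) (*-congʳ (*-identityʳ a))

  *ᴾ-scaleʳ : ∀ b p q q′ → (∀ n → coeff q′ n ≈ b * coeff q n) →
              ∀ n → coeff (p *ᴾ q′) n ≈ b * coeff (p *ᴾ q) n
  *ᴾ-scaleʳ b p q q′ h n =
    ≈-trans (*ᴾ-scale 1# b p p q q′ (λ _ → ≈-sym (*-identityˡ _)) h n) (*-congʳ (*-identityˡ b))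

  *ᴾ-zeroˡ : ∀ p q → (∀ n → coeff p n ≈ 0#) → ∀ n → coeff (p *ᴾ q) n ≈ 0#
  *ᴾ-zeroˡ p q h n =
    ≈-trans (*ᴾ-scaleˡ 0# p p q (λ k → ≈-trans (h k) (≈-sym (zeroˡ _))) n) (zeroˡ _)

  *ᴾ-zeroʳ : ∀ p q → (∀ n → coeff q n ≈ 0#) → ∀ n → coeff (p *ᴾ q) n ≈ 0#
  *ᴾ-zeroʳ p q h n =
    ≈-trans (*ᴾ-scaleʳ 0# p q q (λ k → ≈-trans (h k) (≈-sym (zeroˡ _))) n) (zeroˡ _)

  -- In the convolution at index `i + j` every other product has a factor of index above `i` or
  -- above `j`. Both indices are upper bounds for degrees; the top coefficients may vanish.
  *ᴾ-topCoeff : ∀ p q i j → (∀ k → i ℕ.< k → coeff p k ≈ 0#) →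
                (∀ k → j ℕ.< k → coeff q k ≈ 0#) →
                coeff (p *ᴾ q) (i ℕ.+ j) ≈ coeff p i * coeff q j
  *ᴾ-topCoeff []      q i       j       hp hq = ≈-sym (zeroˡ _)
  *ᴾ-topCoeff (a ∷ p) q zero    zero    hp hq = coeff-*ᴾ-zero a p q
  *ᴾ-topCoeff (a ∷ p) q zero    (suc j) hp hq = begin
    coeff ((a ∷ p) *ᴾ q) (suc j)            ≈⟨ coeff-*ᴾ-suc a p q j ⟩
    a * coeff q (suc j) + coeff (p *ᴾ q) j  ≈⟨ +-congˡ (*ᴾ-zeroˡ p q (λ n → hp (suc n) z<s) j) ⟩
    a * coeff q (suc j) + 0#                ≈⟨ +-identityʳ _ ⟩
    a * coeff q (suc j)                     ∎
  *ᴾ-topCoeff (a ∷ p) q (suc i) j       hp hq = begin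
    coeff ((a ∷ p) *ᴾ q) (suc (i ℕ.+ j))                    ≈⟨ coeff-*ᴾ-suc a p q _ ⟩
    a * coeff q (suc (i ℕ.+ j)) + coeff (p *ᴾ q) (i ℕ.+ j)  ≈⟨ +-cong (*-congˡ (hq _ (s≤s (ℕ.m≤n+m j i)))) (*ᴾ-topCoeff p q i j (λ k i<k → hp (suc k) (s<s i<k)) hq) ⟩
    a * 0# + coeff p i * coeff q j                          ≈⟨ +-congʳ (zeroʳ a) ⟩
    0# + coeff p i * coeff q j                              ≈⟨ +-identityˡ _ ⟩
    coeff p i * coeff q j                                   ∎

-- Gauss's lemma and Eisenstein's criterion over ℤ

module ℤ[X] = PolynomialProperties ℤ.+-*-commutativeRing

module IntegerPolynomials where
  open ℤ[X]
  open CommutativeSemigroupProperties ℤ.*-commutativeSemigroup using (interchange)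

  Constant : Poly → Set
  Constant P = ∀ k → coeff P (suc k) ≡ 0ℤ

  degree : ∀ P → (∀ k → coeff P k ≡ 0ℤ) ⊎
                 (∃[ i ] (coeff P i ≢ 0ℤ × (∀ k → i ℕ.< k → coeff P k ≡ 0ℤ)))
  degree []      = inj₁ λ _ → refl
  degree (a ∷ P) with degree P
  ... | inj₂ (i , nz , h) = inj₂ (suc i , nz , λ { (suc k) (s≤s i<k) → h k i<k })
  ... | inj₁ P≈0 with a ℤ.≟ 0ℤ
  ...   | yes a≡0 = inj₁ λ { zero → a≡0 ; (suc k) → P≈0 k }
  ...   | no  a≢0 = inj₂ (0 , a≢0 , λ { (suc k) _ → P≈0 k })

  -- The indices `i` and `j` are at most the true degrees, and the leading coefficients have a
  -- nonzero product because ℤ is a domain.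
  degree-+ : ∀ P Q n → (∀ k → n ℕ.< k → coeff (P *ᴾ Q) k ≡ 0ℤ) →
             ∀ i j → coeff P i ≢ 0ℤ → coeff Q j ≢ 0ℤ → i ℕ.+ j ℕ.≤ n
  degree-+ P Q n h i j Pᵢ≢0 Qⱼ≢0 with degree P | degree Q
  ... | inj₁ P≈0 | _        = contradiction (P≈0 i) Pᵢ≢0
  ... | inj₂ _   | inj₁ Q≈0 = contradiction (Q≈0 j) Qⱼ≢0
  ... | inj₂ (I , P_I≢0 , hP) | inj₂ (J , Q_J≢0 , hQ) =
    ℕ.≤-trans (ℕ.+-mono-≤ (ℕ.≮⇒≥ (Pᵢ≢0 ∘ hP i)) (ℕ.≮⇒≥ (Qⱼ≢0 ∘ hQ j)))
      (ℕ.≮⇒≥ λ n<I+J → [ P_I≢0 , Q_J≢0 ]′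
        (ℤ.i*j≡0⇒i≡0∨j≡0 _ (≡.trans (≡.sym (*ᴾ-topCoeff P Q I J hP hQ)) (h _ n<I+J))))

  module Eisenstein {p : ℕ} (pr : Prime p) where

    instance
      p≢0 : ℕ.NonZero p
      p≢0 = prime⇒nonZero pr

    π : ℤ
    π = + p

    euclid : ∀ a b → π ∣ a ℤ.* b → π ∣ a ⊎ π ∣ b
    euclid a b h with euclidsLemma ℤ.∣ a ∣ ℤ.∣ b ∣ pr (subst (p ℕ.∣_) (ℤ.abs-* a b) (∣⇒∣ᵤ h))
    ... | inj₁ x = inj₁ (∣ᵤ⇒∣ x)
    ... | inj₂ y = inj₂ (∣ᵤ⇒∣ y)

    π∣0 : π ∣ 0ℤ
    π∣0 = divides 0ℤ refl

    -- The order of vanishing at 0 of the reduction of `P` modulo `p`, if that reduction is nonzero.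
    leastIndex : ∀ P → (∀ k → π ∣ coeff P k) ⊎
                (∃[ i ] (¬ π ∣ coeff P i × (∀ k → k ℕ.< i → π ∣ coeff P k)))
    leastIndex []      = inj₁ λ _ → π∣0
    leastIndex (a ∷ P) with π ∣? a
    ... | no  π∤a = inj₂ (0 , π∤a , λ _ ())
    ... | yes π∣a with leastIndex P
    ...   | inj₁ h            = inj₁ λ { zero → π∣a ; (suc k) → h k }
    ...   | inj₂ (i , nd , h) = inj₂ (suc i , nd , λ { zero _ → π∣a ; (suc k) (s≤s k<i) → h k k<i })

    ∣-*ᴾˡ : ∀ P Q → (∀ k → π ∣ coeff P k) → ∀ k → π ∣ coeff (P *ᴾ Q) k
    ∣-*ᴾˡ []      Q h k       = π∣0
    ∣-*ᴾˡ (a ∷ P) Q h zero    = subst (π ∣_) (≡.sym (coeff-*ᴾ-zero a P Q)) (∣m⇒∣m*n _ (h 0))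
    ∣-*ᴾˡ (a ∷ P) Q h (suc k) = subst (π ∣_) (≡.sym (coeff-*ᴾ-suc a P Q k))
      (∣m∣n⇒∣m+n (∣m⇒∣m*n _ (h 0)) (∣-*ᴾˡ P Q (h ∘ suc) k))

    -- Truncated at `j`, unlike `∣-*ᴾˡ`, because `∤-*ᴾ` knows divisibility only for the coefficients
    -- of `Q` below its least index.
    ∣-*ᴾʳ : ∀ P Q j → (∀ k → k ℕ.< j → π ∣ coeff Q k) → ∀ k → k ℕ.< j → π ∣ coeff (P *ᴾ Q) k
    ∣-*ᴾʳ []      Q j h k       k<j = π∣0
    ∣-*ᴾʳ (a ∷ P) Q j h zero    k<j = subst (π ∣_) (≡.sym (coeff-*ᴾ-zero a P Q)) (∣n⇒∣m*n a (h 0 k<j))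
    ∣-*ᴾʳ (a ∷ P) Q j h (suc k) k<j = subst (π ∣_) (≡.sym (coeff-*ᴾ-suc a P Q k))
      (∣m∣n⇒∣m+n (∣n⇒∣m*n a (h _ k<j)) (∣-*ᴾʳ P Q j h k (ℕ.<-trans (ℕ.n<1+n k) k<j)))

    -- Modulo `π` the lowest terms of `P` and `Q` multiply to the lowest term of the product, since
    -- ℤ/p is a domain.
    ∤-*ᴾ : ∀ P Q i j → (∀ k → k ℕ.< i → π ∣ coeff P k) → (∀ k → k ℕ.< j → π ∣ coeff Q k) →
           ¬ π ∣ coeff P i → ¬ π ∣ coeff Q j → ¬ π ∣ coeff (P *ᴾ Q) (i ℕ.+ j)
    ∤-*ᴾ []      Q i       j       hP hQ nP nQ d = nP π∣0
    ∤-*ᴾ (a ∷ P) Q zero    zero    hP hQ nP nQ d =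
      [ nP , nQ ]′ (euclid _ _ (subst (π ∣_) (coeff-*ᴾ-zero a P Q) d))
    ∤-*ᴾ (a ∷ P) Q zero    (suc j) hP hQ nP nQ d =
      [ nP , nQ ]′ (euclid _ _ (∣m+n∣n⇒∣m (subst (π ∣_) (coeff-*ᴾ-suc a P Q j) d)
                                 (∣-*ᴾʳ P Q (suc j) hQ j (ℕ.n<1+n j))))
    ∤-*ᴾ (a ∷ P) Q (suc i) j       hP hQ nP nQ d =
      ∤-*ᴾ P Q i j (λ k k<i → hP (suc k) (s<s k<i)) hQ nP nQ
        (∣m+n∣m⇒∣n (subst (π ∣_) (coeff-*ᴾ-suc a P Q (i ℕ.+ j)) d) (∣m⇒∣m*n _ (hP 0 z<s)))

    unscale : ∀ P → (∀ k → π ∣ coeff P k) → ∃[ P′ ] (∀ k → coeff P k ≡ π ℤ.* coeff P′ k)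
    unscale []      h = [] , λ _ → ≡.sym (ℤ.*-zeroʳ π)
    unscale (a ∷ P) h with h 0 | unscale P (h ∘ suc)
    ... | divides q eq | P′ , h′ = q ∷ P′ , λ { zero → ≡.trans eq (ℤ.*-comm q π) ; (suc k) → h′ k }

    -- Euclid's lemma applied twice; cancelling one `π` after the first use leaves an equation for
    -- the second.
    ∣-*-∤ : ∀ N x → ¬ π ∣ N → π ℤ.* π ∣ N ℤ.* x → π ℤ.* π ∣ x
    ∣-*-∤ N x π∤N (divides q eq) with euclid N x (divides (q ℤ.* π) (≡.trans eq (≡.sym (ℤ.*-assoc q π π))))
    ... | inj₁ π∣N = contradiction π∣N π∤N
    ... | inj₂ (divides y refl) with euclid N y (divides q
            (ℤ.*-cancelʳ-≡ _ _ π (≡.trans (ℤ.*-assoc N y π) (≡.trans eq (≡.sym (ℤ.*-assoc q π π))))))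
    ...   | inj₁ π∣N = contradiction π∣N π∤N
    ...   | inj₂ (divides z refl) = divides z (ℤ.*-assoc z π π)

    module _ (F : Poly) (n : ℕ) (0<n : 0 ℕ.< n) (F>n : ∀ k → n ℕ.< k → coeff F k ≡ 0ℤ)
             (π∤Fₙ : ¬ π ∣ coeff F n) (π∣F : ∀ k → k ℕ.< n → π ∣ coeff F k)
             (π²∤F₀ : ¬ π ℤ.* π ∣ coeff F 0) where

      -- If π ∣ N, then π divides one of the factors by ∤-*ᴾ, and can be cancelled.
      -- Otherwise let i, j be the least indices of coefficients of P and Q that are
      -- not divisible by π.  Then i + j = n, and i, j > 0 would imply π² ∣ N F₀.
      factor-constant : ∀ N → N ≢ 0ℤ → ∀ P Q → (∀ k → coeff (P *ᴾ Q) k ≡ N ℤ.* coeff F k) →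
                        Constant P ⊎ Constant Q
      factor-constant N = <-rec Descent step ℤ.∣ N ∣ N refl
        where
        Descent : ℕ → Set
        Descent m = ∀ N → ℤ.∣ N ∣ ≡ m → N ≢ 0ℤ → ∀ P Q →
                    (∀ k → coeff (P *ᴾ Q) k ≡ N ℤ.* coeff F k) → Constant P ⊎ Constant Q

        Constant-scale : ∀ P P′ → (∀ k → coeff P k ≡ π ℤ.* coeff P′ k) → Constant P′ → Constant P
        Constant-scale P P′ h c k = ≡.trans (h (suc k)) (≡.trans (cong (π ℤ.*_) (c k)) (ℤ.*-zeroʳ π))

        cancel : ∀ {x y} N → π ℤ.* x ≡ (N ℤ.* π) ℤ.* y → x ≡ N ℤ.* y
        cancel {x} {y} N eq = ℤ.*-cancelˡ-≡ π _ _ (begin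
          π ℤ.* x          ≡⟨ eq ⟩
          (N ℤ.* π) ℤ.* y  ≡⟨ cong (ℤ._* y) (ℤ.*-comm N π) ⟩
          (π ℤ.* N) ℤ.* y  ≡⟨ ℤ.*-assoc π N y ⟩
          π ℤ.* (N ℤ.* y)  ∎)
          where open ≡.≡-Reasoning

        coprime-case : ∀ N → ¬ π ∣ N → ∀ P Q → (∀ k → coeff (P *ᴾ Q) k ≡ N ℤ.* coeff F k) →
                       ∀ i j → (∀ k → k ℕ.< i → π ∣ coeff P k) → (∀ k → k ℕ.< j → π ∣ coeff Q k) →
                       ¬ π ∣ coeff P i → ¬ π ∣ coeff Q j → Constant P ⊎ Constant Q
        coprime-case N π∤N P Q PQ i j hP hQ nP nQ = case-split i j i+j≡n hP hQ nP nQ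
          where
          π∤PQ : ¬ π ∣ N ℤ.* coeff F (i ℕ.+ j)
          π∤PQ d = ∤-*ᴾ P Q i j hP hQ nP nQ (subst (π ∣_) (≡.sym (PQ _)) d)

          i+j≡n : i ℕ.+ j ≡ n
          -- Only index `n` remains: below it `π` divides the coefficients of `F`, and above it they
          -- are zero.
          i+j≡n with ℕ.<-cmp (i ℕ.+ j) n
          ... | tri< lt _ _ = contradiction (∣n⇒∣m*n N (π∣F _ lt)) π∤PQ
          ... | tri≈ _ eq _ = eq
          ... | tri> _ _ gt = contradiction (∣n⇒∣m*n N (subst (π ∣_) (≡.sym (F>n _ gt)) π∣0)) π∤PQ

          degrees : ∀ i j → coeff P i ≢ 0ℤ → coeff Q j ≢ 0ℤ → i ℕ.+ j ℕ.≤ n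
          degrees = degree-+ P Q n λ k n<k →
            ≡.trans (PQ k) (≡.trans (cong (N ℤ.*_) (F>n k n<k)) (ℤ.*-zeroʳ N))

          ∤⇒≢0 : ∀ {x} → ¬ π ∣ x → x ≢ 0ℤ
          ∤⇒≢0 π∤x refl = π∤x π∣0

          case-split : ∀ i j → i ℕ.+ j ≡ n →
                       (∀ k → k ℕ.< i → π ∣ coeff P k) → (∀ k → k ℕ.< j → π ∣ coeff Q k) →
                       ¬ π ∣ coeff P i → ¬ π ∣ coeff Q j → Constant P ⊎ Constant Q
          -- Here `j = n`, so `Q` has a nonzero coefficient at `n`, and one of `P` beyond the
          -- constant term would push the degree of the product past `n`.
          case-split zero j refl hP hQ nP nQ = inj₁ λ k → decidable-stable (_ ℤ.≟ _) λ Pk≢0 →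
            ℕ.<-irrefl refl (ℕ.≤-trans (s≤s (ℕ.m≤n+m j k)) (degrees (suc k) j Pk≢0 (∤⇒≢0 nQ)))
          case-split (suc i) zero i≡n hP hQ nP nQ = inj₂ λ k → decidable-stable (_ ℤ.≟ _) λ Qk≢0 →
            ℕ.m+1+n≰m n (subst (λ m → m ℕ.+ suc k ℕ.≤ n) (≡.trans (≡.sym (ℕ.+-identityʳ (suc i))) i≡n)
                               (degrees (suc i) (suc k) (∤⇒≢0 nP) Qk≢0))
          case-split (suc i) (suc j) i+j≡n hP hQ nP nQ with hP 0 z<s | hQ 0 z<s
          ... | divides a P₀≡ | divides b Q₀≡ = contradiction (∣-*-∤ N _ π∤N (divides (a ℤ.* b) eq)) π²∤F₀
            where
            open ≡.≡-Reasoning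
            eq : N ℤ.* coeff F 0 ≡ (a ℤ.* b) ℤ.* (π ℤ.* π)
            eq = begin
              N ℤ.* coeff F 0              ≡⟨ PQ 0 ⟨
              coeff (P *ᴾ Q) 0             ≡⟨ coeff₀-*ᴾ P Q ⟩
              coeff P 0 ℤ.* coeff Q 0      ≡⟨ cong₂ ℤ._*_ P₀≡ Q₀≡ ⟩
              (a ℤ.* π) ℤ.* (b ℤ.* π)      ≡⟨ interchange a π b π ⟩
              (a ℤ.* b) ℤ.* (π ℤ.* π)      ∎

        step : ∀ m → (∀ {l} → l ℕ.< m → Descent l) → Descent m
        step m rec N refl N≢0 P Q PQ with π ∣? N | leastIndex P | leastIndex Q
        -- If `π` divided all of `P`, it would divide `N Fₙ`, hence `N` or `Fₙ`.
        ... | no π∤N | inj₁ π∣P | _ =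
          contradiction (subst (π ∣_) (PQ n) (∣-*ᴾˡ P Q π∣P n)) λ d → [ π∤N , π∤Fₙ ]′ (euclid _ _ d)
        ... | no π∤N | inj₂ _ | inj₁ π∣Q =
          contradiction (subst (π ∣_) (PQ n) (∣-*ᴾʳ P Q (suc n) (λ k _ → π∣Q k) n (ℕ.n<1+n n)))
                        λ d → [ π∤N , π∤Fₙ ]′ (euclid _ _ d)
        ... | no π∤N | inj₂ (i , nP , hP) | inj₂ (j , nQ , hQ) = coprime-case N π∤N P Q PQ i j hP hQ nP nQ
        ... | yes (divides N′ refl) | leastP | leastQ = descend leastP leastQ
          where
          N′≢0 : N′ ≢ 0ℤ
          N′≢0 refl = N≢0 refl

          ∣N′∣<∣N∣ : ℤ.∣ N′ ∣ ℕ.< ℤ.∣ N′ ℤ.* π ∣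
          ∣N′∣<∣N∣ = subst (ℤ.∣ N′ ∣ ℕ.<_) (≡.sym (ℤ.abs-* N′ π))
            (ℕ.m<m*n _ p {{ℤ.≢-nonZero N′≢0}} (ℕ.nonTrivial⇒n>1 p {{prime⇒nonTrivial pr}}))

          descend : _ → _ → Constant P ⊎ Constant Q
          descend (inj₁ π∣P) _ with unscale P π∣P
          ... | P′ , hP = map₁ (Constant-scale P P′ hP) (rec ∣N′∣<∣N∣ N′ refl N′≢0 P′ Q λ k →
            cancel N′ (≡.trans (≡.sym (*ᴾ-scaleˡ π P′ P Q hP k)) (PQ k)))
          descend (inj₂ _) (inj₁ π∣Q) with unscale Q π∣Q
          ... | Q′ , hQ = map₂ (Constant-scale Q Q′ hQ) (rec ∣N′∣<∣N∣ N′ refl N′≢0 P Q′ λ k →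
            cancel N′ (≡.trans (≡.sym (*ᴾ-scaleʳ π P Q′ Q hQ k)) (PQ k)))
          -- Gauss's lemma: `π ∣ N` makes every coefficient of the product divisible by `π`, yet the
          -- one at `i + j` is not.
          descend (inj₂ (i , nP , hP)) (inj₂ (j , nQ , hQ)) =
            contradiction (subst (π ∣_) (≡.sym (PQ (i ℕ.+ j))) (∣m⇒∣m*n _ (divides N′ refl)))
                          (∤-*ᴾ P Q i j hP hQ nP nQ)

open IntegerPolynomials

-- From ℚ[X] to ℤ[X]: clearing denominators

module ℚ[X]-Properties = PolynomialProperties ℚ.+-*-commutativeRing

-- The division `i / 1` normalises by a gcd that is stuck for a variable `i`; rewriting with this
-- equation exposes numerator and denominator.
fromℤ-mkℚ : ∀ i → fromℤ i ≡ mkℚ i 0 (Coprimality.sym (Coprimality.1-coprimeTo ℤ.∣ i ∣))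
fromℤ-mkℚ i = ℚ.↥p/↧p≡p (mkℚ i 0 _)

fromℤ-+ : ∀ i j → fromℤ (i ℤ.+ j) ≡ fromℤ i ℚ.+ fromℤ j
fromℤ-+ i j rewrite fromℤ-mkℚ i | fromℤ-mkℚ j =
  cong (ℚ._/ 1) (≡.sym (cong₂ ℤ._+_ (ℤ.*-identityʳ i) (ℤ.*-identityʳ j)))

fromℤ-* : ∀ i j → fromℤ (i ℤ.* j) ≡ fromℤ i ℚ.* fromℤ j
fromℤ-* i j rewrite fromℤ-mkℚ i | fromℤ-mkℚ j = refl

fromℤ-neg : ∀ i → fromℤ (ℤ.- i) ≡ ℚ.- fromℤ i
fromℤ-neg (+ 0)      = refl
fromℤ-neg ℤ.+[1+ n ] = refl
fromℤ-neg ℤ.-[1+ n ] = ≡.sym (neg-involutive (fromℤ ℤ.+[1+ n ]))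
  where open RingProperties ℚ.+-*-ring renaming (-‿involutive to neg-involutive)

fromℤ-injective : ∀ {i j} → fromℤ i ≡ fromℤ j → i ≡ j
fromℤ-injective {i} {j} eq = cong ℚ.↥_ (≡.trans (≡.sym (fromℤ-mkℚ i)) (≡.trans eq (fromℤ-mkℚ j)))

fromℤ-mono-≤ : ∀ {i j} → i ℤ.≤ j → fromℤ i ℚ.≤ fromℤ j
fromℤ-mono-≤ {i} {j} i≤j rewrite fromℤ-mkℚ i | fromℤ-mkℚ j = *≤* (ℤ.*-monoʳ-≤-nonNeg (+ 1) i≤j)

fromℤ-mono-< : ∀ {i j} → i ℤ.< j → fromℤ i ℚ.< fromℤ j
fromℤ-mono-< {i} {j} i<j rewrite fromℤ-mkℚ i | fromℤ-mkℚ j = *<* (ℤ.*-monoʳ-<-pos (+ 1) i<j)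

coeff-map : ∀ P k → ℚ[X].coeff (map fromℤ P) k ≡ fromℤ (ℤ[X].coeff P k)
coeff-map []      k       = refl
coeff-map (a ∷ P) zero    = refl
coeff-map (a ∷ P) (suc k) = coeff-map P k

coeff-map-*ᴾ : ∀ P Q k → ℚ[X].coeff (map fromℤ P ℚ[X].*ᴾ map fromℤ Q) k ≡
               fromℤ (ℤ[X].coeff (P ℤ[X].*ᴾ Q) k)
coeff-map-*ᴾ []      Q k       = refl
coeff-map-*ᴾ (a ∷ P) Q zero    = begin
  _                                         ≡⟨ ℚ[X]-Properties.coeff-*ᴾ-zero (fromℤ a) (map fromℤ P) (map fromℤ Q) ⟩
  fromℤ a ℚ.* ℚ[X].coeff (map fromℤ Q) 0    ≡⟨ cong (fromℤ a ℚ.*_) (coeff-map Q 0) ⟩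
  fromℤ a ℚ.* fromℤ (ℤ[X].coeff Q 0)        ≡⟨ fromℤ-* a (ℤ[X].coeff Q 0) ⟨
  fromℤ (a ℤ.* ℤ[X].coeff Q 0)              ≡⟨ cong fromℤ (ℤ[X].coeff-*ᴾ-zero a P Q) ⟨
  _                                         ∎
  where open ≡.≡-Reasoning
coeff-map-*ᴾ (a ∷ P) Q (suc k) = begin
  _                                            ≡⟨ ℚ[X]-Properties.coeff-*ᴾ-suc (fromℤ a) (map fromℤ P) (map fromℤ Q) k ⟩
  fromℤ a ℚ.* ℚ[X].coeff (map fromℤ Q) (suc k) ℚ.+ ℚ[X].coeff (map fromℤ P ℚ[X].*ᴾ map fromℤ Q) k
                                               ≡⟨ cong₂ (λ x y → fromℤ a ℚ.* x ℚ.+ y) (coeff-map Q (suc k)) (coeff-map-*ᴾ P Q k) ⟩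
  fromℤ a ℚ.* fromℤ (ℤ[X].coeff Q (suc k)) ℚ.+ fromℤ (ℤ[X].coeff (P ℤ[X].*ᴾ Q) k)
                                               ≡⟨ cong (ℚ._+ _) (fromℤ-* a (ℤ[X].coeff Q (suc k))) ⟨
  fromℤ (a ℤ.* ℤ[X].coeff Q (suc k)) ℚ.+ fromℤ (ℤ[X].coeff (P ℤ[X].*ᴾ Q) k)
                                               ≡⟨ fromℤ-+ (a ℤ.* ℤ[X].coeff Q (suc k)) (ℤ[X].coeff (P ℤ[X].*ᴾ Q) k) ⟨
  fromℤ (a ℤ.* ℤ[X].coeff Q (suc k) ℤ.+ ℤ[X].coeff (P ℤ[X].*ᴾ Q) k)
                                               ≡⟨ cong fromℤ (ℤ[X].coeff-*ᴾ-suc a P Q k) ⟨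
  _                                            ∎
  where open ≡.≡-Reasoning

-- Shown for unnormalised rationals, where equality is cross-multiplication and no gcd interferes.
↧-* : ∀ x → fromℤ (ℚ.↧ x) ℚ.* x ≡ fromℤ (ℚ.↥ x)
↧-* x@(mkℚ n d-1 _) = ℚ.toℚᵘ-injective (begin
  ℚ.toℚᵘ (fromℤ (ℚ.↧ x) ℚ.* x)             ≈⟨ ℚ.toℚᵘ-homo-* (fromℤ (ℚ.↧ x)) x ⟩
  ℚ.toℚᵘ (fromℤ (ℚ.↧ x)) ℚᵘ.* ℚ.toℚᵘ x     ≈⟨ ℚᵘ.*-congʳ (ℚ.toℚᵘ-fromℚᵘ (ℚᵘ.mkℚᵘ (ℚ.↧ x) 0)) ⟩
  ℚᵘ.mkℚᵘ (ℚ.↧ x) 0 ℚᵘ.* ℚ.toℚᵘ x          ≈⟨ ℚᵘ.*≡* eq ⟩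
  ℚᵘ.mkℚᵘ n 0                              ≈⟨ ℚ.toℚᵘ-fromℚᵘ (ℚᵘ.mkℚᵘ n 0) ⟨
  ℚ.toℚᵘ (fromℤ n)                         ∎)
  where
  open import Relation.Binary.Reasoning.Setoid ℚᵘ.≃-setoid
  eq : (ℚ.↧ x ℤ.* n) ℤ.* + 1 ≡ n ℤ.* (+ suc (d-1 ℕ.+ 0))
  eq = ≡.trans (ℤ.*-identityʳ _) (≡.trans (ℤ.*-comm (ℚ.↧ x) n) (cong (λ m → n ℤ.* + suc m) (≡.sym (ℕ.+-identityʳ d-1))))

_≋_·_ : ℤ[X].Poly → ℤ → ℚ[X].Poly → Set
P ≋ N · p = ∀ k → fromℤ (ℤ[X].coeff P k) ≡ fromℤ N ℚ.* ℚ[X].coeff p k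

-- `N` is the product of all denominators. It may share factors with every coefficient of `P`; the
-- descent in `factor-constant` copes with them.
clear : ∀ p → ∃[ N ] ∃[ P ] (N ≢ 0ℤ × P ≋ N · p)
clear []      = 1ℤ , [] , (λ ()) , λ _ → ≡.sym (ℚ.*-zeroʳ (fromℤ 1ℤ))
clear (x ∷ p) with clear p
... | N , P , N≢0 , h = ℚ.↧ x ℤ.* N , N ℤ.* ℚ.↥ x ∷ map (ℚ.↧ x ℤ.*_) P ,
    (λ eq → [ (λ ()) , N≢0 ]′ (ℤ.i*j≡0⇒i≡0∨j≡0 (ℚ.↧ x) eq)) , h′
  where
  open ≡.≡-Reasoning
  open CommutativeSemigroupProperties (CommutativeRing.*-commutativeSemigroup ℚ.+-*-commutativeRing)
    using (x∙yz≈y∙xz)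
  h′ : (N ℤ.* ℚ.↥ x ∷ map (ℚ.↧ x ℤ.*_) P) ≋ (ℚ.↧ x ℤ.* N) · (x ∷ p)
  h′ zero = begin
    fromℤ (N ℤ.* ℚ.↥ x)                ≡⟨ fromℤ-* N (ℚ.↥ x) ⟩
    fromℤ N ℚ.* fromℤ (ℚ.↥ x)          ≡⟨ cong (fromℤ N ℚ.*_) (↧-* x) ⟨
    fromℤ N ℚ.* (fromℤ (ℚ.↧ x) ℚ.* x)  ≡⟨ x∙yz≈y∙xz (fromℤ N) (fromℤ (ℚ.↧ x)) x ⟩
    fromℤ (ℚ.↧ x) ℚ.* (fromℤ N ℚ.* x)  ≡⟨ ℚ.*-assoc (fromℤ (ℚ.↧ x)) (fromℤ N) x ⟨
    fromℤ (ℚ.↧ x) ℚ.* fromℤ N ℚ.* x    ≡⟨ cong (ℚ._* x) (fromℤ-* (ℚ.↧ x) N) ⟨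
    fromℤ (ℚ.↧ x ℤ.* N) ℚ.* x          ∎
  h′ (suc k) = begin
    fromℤ (ℤ[X].coeff (map (ℚ.↧ x ℤ.*_) P) k)            ≡⟨ cong fromℤ (ℤ[X].coeff-scale (ℚ.↧ x) P k) ⟩
    fromℤ (ℚ.↧ x ℤ.* ℤ[X].coeff P k)                     ≡⟨ fromℤ-* (ℚ.↧ x) (ℤ[X].coeff P k) ⟩
    fromℤ (ℚ.↧ x) ℚ.* fromℤ (ℤ[X].coeff P k)             ≡⟨ cong (fromℤ (ℚ.↧ x) ℚ.*_) (h k) ⟩
    fromℤ (ℚ.↧ x) ℚ.* (fromℤ N ℚ.* ℚ[X].coeff p k)       ≡⟨ ℚ.*-assoc (fromℤ (ℚ.↧ x)) (fromℤ N) _ ⟨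
    fromℤ (ℚ.↧ x) ℚ.* fromℤ N ℚ.* ℚ[X].coeff p k         ≡⟨ cong (ℚ._* ℚ[X].coeff p k) (fromℤ-* (ℚ.↧ x) N) ⟨
    fromℤ (ℚ.↧ x ℤ.* N) ℚ.* ℚ[X].coeff p k               ∎

≋·-* : ∀ N M P Q p q F → P ≋ N · p → Q ≋ M · q → (p ℚ[X].*ᴾ q) ℚ[X].≈ᴾ map fromℤ F →
       ∀ k → ℤ[X].coeff (P ℤ[X].*ᴾ Q) k ≡ (N ℤ.* M) ℤ.* ℤ[X].coeff F k
≋·-* N M P Q p q F hP hQ h k = fromℤ-injective (begin
  fromℤ (ℤ[X].coeff (P ℤ[X].*ᴾ Q) k)
    ≡⟨ coeff-map-*ᴾ P Q k ⟨
  ℚ[X].coeff (map fromℤ P ℚ[X].*ᴾ map fromℤ Q) k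
    ≡⟨ ℚ[X]-Properties.*ᴾ-scale (fromℤ N) (fromℤ M) p (map fromℤ P) q (map fromℤ Q)
         (λ n → ≡.trans (coeff-map P n) (hP n)) (λ n → ≡.trans (coeff-map Q n) (hQ n)) k ⟩
  fromℤ N ℚ.* fromℤ M ℚ.* ℚ[X].coeff (p ℚ[X].*ᴾ q) k
    ≡⟨ cong₂ ℚ._*_ (≡.sym (fromℤ-* N M)) (≡.trans (h k) (coeff-map F k)) ⟩
  fromℤ (N ℤ.* M) ℚ.* fromℤ (ℤ[X].coeff F k)
    ≡⟨ fromℤ-* (N ℤ.* M) (ℤ[X].coeff F k) ⟨
  fromℤ ((N ℤ.* M) ℤ.* ℤ[X].coeff F k) ∎)
  where open ≡.≡-Reasoning

ℚ-x*y≡0⇒y≡0 : ∀ {x y} → x ≢ 0ℚ → x ℚ.* y ≡ 0ℚ → y ≡ 0ℚ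
ℚ-x*y≡0⇒y≡0 {x} {y} x≢0 xy≡0 = begin
  y                     ≡⟨ ℚ.*-identityˡ y ⟨
  1ℚ ℚ.* y              ≡⟨ cong (ℚ._* y) (ℚ.*-inverseˡ x) ⟨
  (ℚ.1/ x) ℚ.* x ℚ.* y  ≡⟨ ℚ.*-assoc (ℚ.1/ x) x y ⟩
  ℚ.1/ x ℚ.* (x ℚ.* y)  ≡⟨ cong (ℚ.1/ x ℚ.*_) xy≡0 ⟩
  ℚ.1/ x ℚ.* 0ℚ         ≡⟨ ℚ.*-zeroʳ (ℚ.1/ x) ⟩
  0ℚ                    ∎
  where
  open ≡.≡-Reasoning
  instance _ = ℚ.≢-nonZero x≢0

≋·-constant : ∀ N P p → N ≢ 0ℤ → P ≋ N · p → Constant P → ∀ k → ℚ[X].coeff p (suc k) ≡ 0ℚ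
≋·-constant N P p N≢0 h c k = ℚ-x*y≡0⇒y≡0 (N≢0 ∘ fromℤ-injective)
  (≡.trans (≡.sym (h (suc k))) (cong fromℤ (c k)))

-- Eisenstein's criterion for irreducibility in ℚ[X]

open SemiringDefinitions ℚ[X].polyRawSemiring using (mkIrred) renaming (_∣_ to _∣ᴾ_)

constant-unit : ∀ p → ℚ[X].coeff p 0 ≢ 0ℚ → (∀ k → ℚ[X].coeff p (suc k) ≡ 0ℚ) → p ∣ᴾ (1ℚ ∷ [])
constant-unit p p₀≢0 h = (c ∷ []) , eq
  where
  instance _ = ℚ.≢-nonZero p₀≢0
  c : ℚ
  c = ℚ.1/ ℚ[X].coeff p 0
  eq : ((c ∷ []) ℚ[X].*ᴾ p) ℚ[X].≈ᴾ (1ℚ ∷ [])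
  eq zero    = ≡.trans (ℚ[X]-Properties.coeff-*ᴾ-zero c [] p) (ℚ.*-inverseˡ (ℚ[X].coeff p 0))
  eq (suc k) = ≡.trans (ℚ[X]-Properties.coeff-*ᴾ-suc c [] p k)
    (≡.trans (ℚ.+-identityʳ _) (≡.trans (cong (c ℚ.*_) (h k)) (ℚ.*-zeroʳ c)))

module _ {p : ℕ} (pr : Prime p) (F : ℤ[X].Poly) (n : ℕ) (0<n : 0 ℕ.< n)
         (F>n : ∀ k → n ℕ.< k → ℤ[X].coeff F k ≡ 0ℤ)
         (p∤Fₙ : ¬ + p ∣ ℤ[X].coeff F n) (p∣F : ∀ k → k ℕ.< n → + p ∣ ℤ[X].coeff F k)
         (p²∤F₀ : ¬ + p ℤ.* + p ∣ ℤ[X].coeff F 0) where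

  private
    f : ℚ[X].Poly
    f = map fromℤ F

    Fₙ≢0 : ℤ[X].coeff F n ≢ 0ℤ
    Fₙ≢0 Fₙ≡0 = p∤Fₙ (divides 0ℤ Fₙ≡0)

    fₙ≢0 : ℚ[X].coeff f n ≢ 0ℚ
    fₙ≢0 = Fₙ≢0 ∘ fromℤ-injective ∘ ≡.trans (≡.sym (coeff-map F n))

  -- If q f = 1, clearing denominators gives Q F = M with M ≠ 0. Then Q₀ ≠ 0, and comparing degrees
  -- gives n ≤ 0.
  f∤1 : ¬ f ∣ᴾ (1ℚ ∷ [])
  f∤1 (q , h) with clear q
  ... | M , Q , M≢0 , hQ = ℕ.<⇒≱ 0<n (ℤ[X]-degree-+ 0 n Q₀≢0 Fₙ≢0)
    where
    QF : ∀ k → ℤ[X].coeff (Q ℤ[X].*ᴾ F) k ≡ (M ℤ.* 1ℤ) ℤ.* ℤ[X].coeff (1ℤ ∷ []) k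
    QF = ≋·-* M 1ℤ Q F q f (1ℤ ∷ []) hQ
      (λ k → ≡.trans (≡.sym (coeff-map F k)) (≡.sym (ℚ.*-identityˡ _))) h

    ℤ[X]-degree-+ = degree-+ Q F 0 λ { (suc k) _ → ≡.trans (QF (suc k)) (ℤ.*-zeroʳ (M ℤ.* 1ℤ)) }

    Q₀≢0 : ℤ[X].coeff Q 0 ≢ 0ℤ
    Q₀≢0 Q₀≡0 = M≢0 (begin
      M                                      ≡⟨ ℤ.*-identityʳ M ⟨
      M ℤ.* 1ℤ                               ≡⟨ ℤ.*-identityʳ (M ℤ.* 1ℤ) ⟨
      (M ℤ.* 1ℤ) ℤ.* 1ℤ                      ≡⟨ QF 0 ⟨
      ℤ[X].coeff (Q ℤ[X].*ᴾ F) 0             ≡⟨ ℤ[X].coeff₀-*ᴾ Q F ⟩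
      ℤ[X].coeff Q 0 ℤ.* ℤ[X].coeff F 0      ≡⟨ cong (ℤ._* _) Q₀≡0 ⟩
      0ℤ                                     ∎)
      where open ≡.≡-Reasoning

  eisenstein : Irreducible f
  eisenstein = mkIrred f∤1 split
    where
    split : ∀ {g h} → f ℚ[X].≈ᴾ (g ℚ[X].*ᴾ h) → g ∣ᴾ (1ℚ ∷ []) ⊎ h ∣ᴾ (1ℚ ∷ [])
    split {g} {h} f≈gh with clear g | clear h
    ... | N , G , N≢0 , hG | M , H , M≢0 , hH =
      -- A constant factor is a unit unless it is zero, and a zero factor would annihilate the
      -- nonzero coefficient of `f` at `n`.
      Sum.map (λ c → let g₊ = ≋·-constant N G g N≢0 hG c in
             constant-unit g (λ g₀ → fₙ≢0 (≡.trans (f≈gh n)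
               (ℚ[X]-Properties.*ᴾ-zeroˡ g h (λ { zero → g₀ ; (suc k) → g₊ k }) n))) g₊)
          (λ c → let h₊ = ≋·-constant M H h M≢0 hH c in
             constant-unit h (λ h₀ → fₙ≢0 (≡.trans (f≈gh n)
               (ℚ[X]-Properties.*ᴾ-zeroʳ g h (λ { zero → h₀ ; (suc k) → h₊ k }) n))) h₊)
          (Eisenstein.factor-constant pr F n 0<n F>n p∤Fₙ p∣F p²∤F₀ (N ℤ.* M)
             (λ eq → [ N≢0 , M≢0 ]′ (ℤ.i*j≡0⇒i≡0∨j≡0 N eq)) G H
             (≋·-* N M G H g h F hG hH (λ k → ≡.sym (f≈gh k))))

-- Splitting of shifted Dickson polynomials over a radical extension

dickson : ℚ → ℚ → ℚ[X].Poly
dickson a e = e ∷ fromℤ (+ 5) ℚ.* (a ℚ.* a) ∷ 0ℚ ∷ ℚ.- (fromℤ (+ 5) ℚ.* a) ∷ 0ℚ ∷ 1ℚ ∷ []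

module DicksonSplitting (Ω : AlgebraicallyClosedExtension) where
  open AlgebraicallyClosedExtension Ω using (ι; ι-homo; closed; commutativeRing; IsRingHomomorphism)
  open CommutativeRing commutativeRing renaming (refl to ≈-refl)
  open IsRingHomomorphism ι-homo using (+-homo; *-homo; -‿homo; 0#-homo; 1#-homo)
  open PolynomialProperties commutativeRing using (Poly; coeff; _*ᴾ_; X-_; _≈ᴾ_; eval; coeff-*ᴾ-zero; coeff-*ᴾ-suc)
  open Radicals Ω
  open import Relation.Binary.Reasoning.Setoid setoid

  -- Agrees with ι, but sends 0ℚ and 1ℚ definitionally to 0# and 1#, as needed for
  -- the ring solver to accept goals that mention 0# and 1#.
  ι′ : ℚ → Carrier
  ι′ (mkℚ (+ 0) _ _) = 0#
  ι′ (mkℚ (+ 1) 0 _) = 1#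
  ι′ q               = ι q

  ι′≈ι : ∀ q → ι′ q ≈ ι q
  ι′≈ι q@(mkℚ (+ 0) _ _)                = sym (trans (reflexive (≡.cong ι (ℚ.↥p≡0⇒p≡0 q ≡.refl))) 0#-homo)
  ι′≈ι (mkℚ (+ 1) 0 _)                  = sym 1#-homo
  ι′≈ι (mkℚ (+ 1) (suc _) _)            = ≈-refl
  ι′≈ι (mkℚ (+ (suc (suc _))) zero _)   = ≈-refl
  ι′≈ι (mkℚ (+ (suc (suc _))) (suc _) _) = ≈-refl
  ι′≈ι (mkℚ ℤ.-[1+ _ ] zero _)          = ≈-refl
  ι′≈ι (mkℚ ℤ.-[1+ _ ] (suc _) _)       = ≈-refl

  morphism : ℚ.+-*-rawRing -Raw-AlmostCommutative⟶ fromCommutativeRing commutativeRing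
  morphism = record
    { ⟦_⟧    = ι′
    ; +-homo = λ x y → trans (ι′≈ι _) (trans (+-homo x y) (sym (+-cong (ι′≈ι x) (ι′≈ι y))))
    ; *-homo = λ x y → trans (ι′≈ι _) (trans (*-homo x y) (sym (*-cong (ι′≈ι x) (ι′≈ι y))))
    ; -‿homo = λ x → trans (ι′≈ι _) (trans (-‿homo x) (sym (-‿cong (ι′≈ι x))))
    ; 0-homo = ≈-refl
    ; 1-homo = ≈-refl
    }

  open RingSolver ℚ.+-*-rawRing (fromCommutativeRing commutativeRing) morphism
    (λ x y → Maybe.map (λ eq → reflexive (≡.cong ι′ eq)) (dec⇒maybe (x ℚ.≟ y)))
    using (solve; _:=_; con; _:+_; _:*_; _:-_; :-_; _:^_) renaming (Polynomial to Expr)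

  open SemiringDefinitions (RawRing.rawSemiring rawRing) using (_^_)

  nat : ℕ → Carrier
  nat k = ι (fromℤ (+ k))

  nat′ : ∀ {n} → ℕ → Expr n
  nat′ k = con (fromℤ (+ k))

  coeff-X- : ∀ x g n → coeff ((X- x) *ᴾ g) (suc n) ≈ - x * coeff g (suc n) + coeff g n
  coeff-X- x g n = trans (coeff-*ᴾ-suc (- x) (1# ∷ []) g n) (+-congˡ (helper n))
    where
    helper : ∀ n → coeff ((1# ∷ []) *ᴾ g) n ≈ coeff g n
    helper zero    = trans (coeff-*ᴾ-zero 1# [] g) (*-identityˡ _)
    helper (suc n) = trans (coeff-*ᴾ-suc 1# [] g n) (trans (+-identityʳ _) (*-identityˡ _))

  -- The coefficients of X - x, and of X² - sX + p times the polynomial with coefficients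
  -- g; for arbitrary operations, so as to apply both in Ω and to ring solver expressions.
  module Coefficients {A : Set} (_+′_ _*′_ : A → A → A) (-′_ : A → A) (0′ 1′ : A) where

    linear : A → ℕ → A
    linear x 0             = -′ x
    linear x 1             = 1′
    linear x (suc (suc n)) = 0′

    quadratic : A → A → (ℕ → A) → ℕ → A
    quadratic s p g 0             = p *′ g 0
    quadratic s p g 1             = (p *′ g 1) +′ (-′ (s *′ g 0))
    quadratic s p g (suc (suc n)) = ((p *′ g (suc (suc n))) +′ (-′ (s *′ g (suc n)))) +′ g n

  open Coefficients _+_ _*_ -_ 0# 1#
  module Exprs {n} = Coefficients {Expr n} _:+_ _:*_ :-_ (con 0ℚ) (con 1ℚ)

  quadratic-cong : ∀ s p {g g′} → (∀ n → g n ≈ g′ n) → ∀ n → quadratic s p g n ≈ quadratic s p g′ n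
  quadratic-cong s p h 0             = *-congˡ (h 0)
  quadratic-cong s p h 1             = +-cong (*-congˡ (h 1)) (-‿cong (*-congˡ (h 0)))
  quadratic-cong s p h (suc (suc n)) =
    +-cong (+-cong (*-congˡ (h (suc (suc n)))) (-‿cong (*-congˡ (h (suc n))))) (h n)

  coeff-linear : ∀ x n → coeff ((X- x) *ᴾ (1# ∷ [])) n ≈ linear x n
  coeff-linear x 0             = trans (+-identityʳ _) (*-identityʳ (- x))
  coeff-linear x 1             = trans (+-identityʳ _) (*-identityˡ 1#)
  coeff-linear x (suc (suc n)) = ≈-refl

  -- A pair of roots enters only through its sum and product, so these can be replaced by
  -- expressions free of ζ, u and v taken separately.
  coeff-quadratic : ∀ {x y s p} → x + y ≈ s → x * y ≈ p → ∀ g n →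
                    coeff ((X- x) *ᴾ ((X- y) *ᴾ g)) n ≈ quadratic s p (coeff g) n
  coeff-quadratic {x} {y} {s} {p} x+y≈s x*y≈p g 0 = begin
    coeff ((X- x) *ᴾ ((X- y) *ᴾ g)) 0 ≈⟨ coeff-*ᴾ-zero (- x) (1# ∷ []) ((X- y) *ᴾ g) ⟩
    - x * coeff ((X- y) *ᴾ g) 0       ≈⟨ *-congˡ (coeff-*ᴾ-zero (- y) (1# ∷ []) g) ⟩
    - x * (- y * coeff g 0)           ≈⟨ solve 3 (λ x y g → :- x :* (:- y :* g) := (x :* y) :* g) ≈-refl x y (coeff g 0) ⟩
    (x * y) * coeff g 0               ≈⟨ *-congʳ x*y≈p ⟩
    p * coeff g 0                     ∎
  coeff-quadratic {x} {y} {s} {p} x+y≈s x*y≈p g 1 = begin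
    coeff ((X- x) *ᴾ ((X- y) *ᴾ g)) 1
      ≈⟨ coeff-X- x ((X- y) *ᴾ g) 0 ⟩
    - x * coeff ((X- y) *ᴾ g) 1 + coeff ((X- y) *ᴾ g) 0
      ≈⟨ +-cong (*-congˡ (coeff-X- y g 0)) (coeff-*ᴾ-zero (- y) (1# ∷ []) g) ⟩
    - x * (- y * coeff g 1 + coeff g 0) + - y * coeff g 0
      ≈⟨ solve 4 (λ x y g₀ g₁ → :- x :* (:- y :* g₁ :+ g₀) :+ :- y :* g₀ := (x :* y) :* g₁ :- (x :+ y) :* g₀)
           ≈-refl x y (coeff g 0) (coeff g 1) ⟩
    (x * y) * coeff g 1 - (x + y) * coeff g 0
      ≈⟨ +-cong (*-congʳ x*y≈p) (-‿cong (*-congʳ x+y≈s)) ⟩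
    p * coeff g 1 - s * coeff g 0
      ∎
  coeff-quadratic {x} {y} {s} {p} x+y≈s x*y≈p g (suc (suc n)) = begin
    coeff ((X- x) *ᴾ ((X- y) *ᴾ g)) (suc (suc n))
      ≈⟨ coeff-X- x ((X- y) *ᴾ g) (suc n) ⟩
    - x * coeff ((X- y) *ᴾ g) (suc (suc n)) + coeff ((X- y) *ᴾ g) (suc n)
      ≈⟨ +-cong (*-congˡ (coeff-X- y g (suc n))) (coeff-X- y g n) ⟩
    - x * (- y * coeff g (suc (suc n)) + coeff g (suc n)) + (- y * coeff g (suc n) + coeff g n)
      ≈⟨ solve 5 (λ x y g₀ g₁ g₂ → :- x :* (:- y :* g₂ :+ g₁) :+ (:- y :* g₁ :+ g₀) :=
                                   (x :* y) :* g₂ :- (x :+ y) :* g₁ :+ g₀)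
           ≈-refl x y (coeff g n) (coeff g (suc n)) (coeff g (suc (suc n))) ⟩
    (x * y) * coeff g (suc (suc n)) - (x + y) * coeff g (suc n) + coeff g n
      ≈⟨ +-congʳ (+-cong (*-congʳ x*y≈p) (-‿cong (*-congʳ x+y≈s))) ⟩
    p * coeff g (suc (suc n)) - s * coeff g (suc n) + coeff g n
      ∎

  -- Calculation modulo the ideal generated by `z`. The cofactor `c`, found by polynomial division,
  -- is given explicitly so that the remaining equation is an unconditional identity for the ring
  -- solver.
  modulo : ∀ {z} → z ≈ 0# → ∀ c {x y} → x ≈ y + z * c → x ≈ y
  modulo {z} z≈0 c {x} {y} eq = begin
    x           ≈⟨ eq ⟩
    y + z * c   ≈⟨ +-congˡ (*-congʳ z≈0) ⟩
    y + 0# * c  ≈⟨ +-congˡ (zeroˡ c) ⟩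
    y + 0#      ≈⟨ +-identityʳ y ⟩
    y           ∎

  product : List Carrier → Poly
  product = foldr (λ x g → (X- x) *ᴾ g) (1# ∷ [])

  -- D₅(X, p) - D₅(s, p) for the Dickson polynomial D₅(X, p) = X⁵ - 5pX³ + 5p²X.
  target : Carrier → Carrier → Poly
  target s p = - (s ^ 5 - nat 5 * (p * s ^ 3) + nat 5 * (p ^ 2 * s)) ∷ nat 5 * (p * p) ∷ 0# ∷
               - (nat 5 * p) ∷ 0# ∷ 1# ∷ []

  module _ (α s p : Carrier) where

    -- `α` stands for ζ + ζ⁴ and `- 1# - α` for its conjugate ζ² + ζ³. These are the sums and
    -- products of the root pairs that belong to ζ, ζ⁴ and to ζ², ζ³; the term s² - 2p is u² + v².
    s₁ p₁ s₂ p₂ : Carrier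
    s₁ = α * s
    p₁ = s ^ 2 - nat 2 * p + (- 1# - α) * p
    s₂ = (- 1# - α) * s
    p₂ = s ^ 2 - nat 2 * p + α * p

    expr : Expr 3 → Expr 3 → Expr 3 → ℕ → Expr 3
    expr a s p = Exprs.quadratic (a :* s) (s :^ 2 :- nat′ 2 :* p :+ (:- con 1ℚ :- a) :* p)
                   (Exprs.quadratic ((:- con 1ℚ :- a) :* s) (s :^ 2 :- nat′ 2 :* p :+ a :* p)
                     (Exprs.linear s))

    ω : Expr 3 → Expr 3
    ω a = a :^ 2 :+ a :- con 1ℚ

    -- The factorisation of D₅(X, p) - D₅(s, p) into X - s and two quadratics conjugate over ℚ(√5).
    -- Only the quadratic relation for `α` enters; the cofactors are quotients by it.
    expand : α ^ 2 + α - 1# ≈ 0# → ∀ n → quadratic s₁ p₁ (quadratic s₂ p₂ (linear s)) n ≈ coeff (target s p) n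
    expand golden 0 = modulo golden (p * p * s) (solve 3 (λ a s p → expr a s p 0 :=
      :- (s :^ 5 :- nat′ 5 :* (p :* s :^ 3) :+ nat′ 5 :* (p :^ 2 :* s)) :+ ω a :* (p :* p :* s)) ≈-refl α s p)
    expand golden 1 = modulo golden (nat 2 * (s * s * p) - p * p) (solve 3 (λ a s p → expr a s p 1 :=
      nat′ 5 :* (p :* p) :+ ω a :* (nat′ 2 :* (s :* s :* p) :- p :* p)) ≈-refl α s p)
    expand golden 2 = modulo golden (s * s * s - nat 2 * (s * p)) (solve 3 (λ a s p → expr a s p 2 :=
      con 0ℚ :+ ω a :* (s :* s :* s :- nat′ 2 :* (s :* p))) ≈-refl α s p)
    expand golden 3 = modulo golden (- (s * s)) (solve 3 (λ a s p → expr a s p 3 :=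
      :- (nat′ 5 :* p) :+ ω a :* :- (s :* s)) ≈-refl α s p)
    expand golden 4 = solve 3 (λ a s p → expr a s p 4 := con 0ℚ) ≈-refl α s p
    expand golden 5 = solve 3 (λ a s p → expr a s p 5 := con 1ℚ) ≈-refl α s p
    expand golden (suc (suc (suc (suc (suc (suc n)))))) = solve 3 (λ a s p → expr a s p 6 := con 0ℚ) ≈-refl α s p

  module _ (ζ : Carrier) (Φ₅ : eval (1# ∷ 1# ∷ 1# ∷ 1# ∷ 1# ∷ []) ζ ≈ 0#) (u v : Carrier) where

    private
      α = ζ + ζ ^ 4
      s = u + v
      p = u * v

      Φ : ∀ {n} → Expr n → Expr n
      Φ z = con 1ℚ :+ z :* (con 1ℚ :+ z :* (con 1ℚ :+ z :* (con 1ℚ :+ z :* (con 1ℚ :+ z :* con 0ℚ))))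

      X₁ X₂ X₃ X₄ : Expr 3 → Expr 3 → Expr 3 → Expr 3
      X₁ z u v = z :* u :+ z :^ 4 :* v
      X₂ z u v = z :^ 2 :* u :+ z :^ 3 :* v
      X₃ z u v = z :^ 3 :* u :+ z :^ 2 :* v
      X₄ z u v = z :^ 4 :* u :+ z :* v

    x₁ x₂ x₃ x₄ : Carrier
    x₁ = ζ * u + ζ ^ 4 * v
    x₂ = ζ ^ 2 * u + ζ ^ 3 * v
    x₃ = ζ ^ 3 * u + ζ ^ 2 * v
    x₄ = ζ ^ 4 * u + ζ * v

    ζ⁵≈1 : ζ ^ 5 ≈ 1#
    ζ⁵≈1 = modulo Φ₅ (ζ - 1#) (solve 1 (λ z → z :^ 5 := con 1ℚ :+ Φ z :* (z :- con 1ℚ)) ≈-refl ζ)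

    -- `α` is a Gaussian period of degree two for the fifth roots of unity.
    golden : α ^ 2 + α - 1# ≈ 0#
    golden = modulo Φ₅ (ζ ^ 4 - ζ ^ 3 + nat 2 * ζ - 1#) (solve 1 (λ z →
      (z :+ z :^ 4) :^ 2 :+ (z :+ z :^ 4) :- con 1ℚ :=
      con 0ℚ :+ Φ z :* (z :^ 4 :- z :^ 3 :+ nat′ 2 :* z :- con 1ℚ)) ≈-refl ζ)

    x₁+x₄ : x₁ + x₄ ≈ s₁ α s p
    x₁+x₄ = solve 3 (λ z u v → X₁ z u v :+ X₄ z u v := (z :+ z :^ 4) :* (u :+ v)) ≈-refl ζ u v

    x₂+x₃ : x₂ + x₃ ≈ s₂ α s p
    x₂+x₃ = modulo Φ₅ s (solve 3 (λ z u v → X₂ z u v :+ X₃ z u v :=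
      (:- con 1ℚ :- (z :+ z :^ 4)) :* (u :+ v) :+ Φ z :* (u :+ v)) ≈-refl ζ u v)

    x₁*x₄ : x₁ * x₄ ≈ p₁ α s p
    x₁*x₄ = modulo Φ₅ ((ζ - 1#) * (u * u + v * v + ζ ^ 3 * p) + p) (solve 3 (λ z u v → X₁ z u v :* X₄ z u v :=
      (u :+ v) :^ 2 :- nat′ 2 :* (u :* v) :+ (:- con 1ℚ :- (z :+ z :^ 4)) :* (u :* v)
      :+ Φ z :* ((z :- con 1ℚ) :* (u :* u :+ v :* v :+ z :^ 3 :* (u :* v)) :+ u :* v)) ≈-refl ζ u v)

    x₂*x₃ : x₂ * x₃ ≈ p₂ α s p
    x₂*x₃ = modulo Φ₅ ((ζ - 1#) * (u * u + v * v + ζ * p)) (solve 3 (λ z u v → X₂ z u v :* X₃ z u v :=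
      (u :+ v) :^ 2 :- nat′ 2 :* (u :* v) :+ (z :+ z :^ 4) :* (u :* v)
      :+ Φ z :* ((z :- con 1ℚ) :* (u :* u :+ v :* v :+ z :* (u :* v)))) ≈-refl ζ u v)

    -- The order puts the members of each pair next to each other, as `coeff-quadratic` requires.
    roots : List Carrier
    roots = x₁ ∷ x₄ ∷ x₂ ∷ x₃ ∷ s ∷ []

    product-roots : product roots ≈ᴾ target s p
    product-roots n = begin
      coeff (product roots) n
        ≈⟨ coeff-quadratic x₁+x₄ x₁*x₄ (product (x₂ ∷ x₃ ∷ s ∷ [])) n ⟩
      quadratic _ _ (coeff (product (x₂ ∷ x₃ ∷ s ∷ []))) n
        ≈⟨ quadratic-cong _ _ (coeff-quadratic x₂+x₃ x₂*x₃ (product (s ∷ []))) n ⟩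
      quadratic _ _ (quadratic _ _ (coeff (product (s ∷ [])))) n
        ≈⟨ quadratic-cong _ _ (quadratic-cong _ _ (coeff-linear s)) n ⟩
      quadratic (s₁ α s p) (p₁ α s p) (quadratic (s₂ α s p) (p₂ α s p) (linear s)) n
        ≈⟨ expand α s p golden n ⟩
      coeff (target s p) n
        ∎

  Rationals-+ : ∀ {x y} → Rationals x → Rationals y → Rationals (x + y)
  Rationals-+ (p , p≈x) (q , q≈y) = p ℚ.+ q , trans (+-homo p q) (+-cong p≈x q≈y)

  Rationals-* : ∀ {x y} → Rationals x → Rationals y → Rationals (x * y)
  Rationals-* (p , p≈x) (q , q≈y) = p ℚ.* q , trans (*-homo p q) (*-cong p≈x q≈y)

  Rationals-neg : ∀ {x} → Rationals x → Rationals (- x)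
  Rationals-neg (p , p≈x) = ℚ.- p , trans (-‿homo p) (-‿cong p≈x)

  Rationals-1# : Rationals 1#
  Rationals-1# = 1ℚ , 1#-homo

  Rationals-^ : ∀ {x} → Rationals x → ∀ n → Rationals (x ^ n)
  Rationals-^ x∈ zero    = Rationals-1#
  Rationals-^ x∈ (suc n) = Rationals-* x∈ (Rationals-^ x∈ n)

  Rationals-ι : ∀ q → Rationals (ι q)
  Rationals-ι q = q , ≈-refl

  ⟨⟩-^ : ∀ {K α x} → K 1# → (K ⟨ α ⟩) x → ∀ n → (K ⟨ α ⟩) (x ^ n)
  ⟨⟩-^ 1∈K x∈ zero    = base 1∈K
  ⟨⟩-^ 1∈K x∈ (suc n) = mul x∈ (⟨⟩-^ 1∈K x∈ n)

  ^-cong : ∀ {x y} n → x ≈ y → x ^ n ≈ y ^ n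
  ^-cong zero    x≈y = ≈-refl
  ^-cong (suc n) x≈y = *-cong x≈y (^-cong n x≈y)

  module _ (a e : ℚ) (a≢0 : a ≢ 0ℚ) where

    private
      instance _ = ℚ.≢-nonZero a≢0
      A = ι a
      B = ι (ℚ.1/ a)
      E = ι e
      -- The discriminant of W² + EW + A⁵; below, `r` is a square root of it and `w`, `w′` are the
      -- roots.
      D = E * E - nat 4 * A ^ 5

      A*B≈1 : A * B ≈ 1#
      A*B≈1 = begin
        A * B               ≈⟨ *-homo a (ℚ.1/ a) ⟨
        ι (a ℚ.* ℚ.1/ a)    ≡⟨ ≡.cong ι (ℚ.*-inverseʳ a) ⟩
        ι 1ℚ                ≈⟨ 1#-homo ⟩
        1#                  ∎

      [A*B]^n≈1 : ∀ n → (A * B) ^ n ≈ 1#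
      [A*B]^n≈1 n = trans (^-cong n A*B≈1) (1^n≈1 n)
        where
        1^n≈1 : ∀ n → 1# ^ n ≈ 1#
        1^n≈1 zero    = ≈-refl
        1^n≈1 (suc n) = trans (*-identityˡ _) (1^n≈1 n)

    module Roots (r : Carrier) (hr : eval (- D ∷ 0# ∷ 1# ∷ []) r ≈ 0#) where

      w w′ : Carrier
      w  = ι ℚ.½ * (r - E)
      w′ = ι ℚ.½ * (- E - r)

      r²≈D : r ^ 2 ≈ D
      r²≈D = modulo hr 1# (solve 2 (λ r D →
        r :^ 2 := D :+ (:- D :+ r :* (con 0ℚ :+ r :* (con 1ℚ :+ r :* con 0ℚ))) :* con 1ℚ) ≈-refl r D)

      w+w′≈-E : w + w′ ≈ - E
      w+w′≈-E = solve 2 (λ r E → con ℚ.½ :* (r :- E) :+ con ℚ.½ :* (:- E :- r) := :- E) ≈-refl r E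

      w*w′≈A⁵ : w * w′ ≈ A ^ 5
      w*w′≈A⁵ = begin
        w * w′                        ≈⟨ solve 2 (λ r E → (con ℚ.½ :* (r :- E)) :* (con ℚ.½ :* (:- E :- r)) :=
                                                          con (ℚ.½ ℚ.* ℚ.½) :* (E :* E :- r :^ 2)) ≈-refl r E ⟩
        ι (ℚ.½ ℚ.* ℚ.½) * (E * E - r ^ 2)
                                      ≈⟨ *-congˡ (+-congˡ (-‿cong r²≈D)) ⟩
        ι (ℚ.½ ℚ.* ℚ.½) * (E * E - D) ≈⟨ solve 2 (λ A E →
          con (ℚ.½ ℚ.* ℚ.½) :* (E :* E :- (E :* E :- nat′ 4 :* A :^ 5)) := A :^ 5) ≈-refl A E ⟩
        A ^ 5                         ∎

      module _ (u : Carrier) (hu : eval (- w ∷ 0# ∷ 0# ∷ 0# ∷ 0# ∷ 1# ∷ []) u ≈ 0#) where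

        -- v = a / u, written without dividing by u: 1 / u = u⁴w′ / a⁵.
        v : Carrier
        v = u ^ 4 * w′ * B ^ 4

        u⁵≈w : u ^ 5 ≈ w
        u⁵≈w = modulo hu 1# (solve 2 (λ u w → u :^ 5 := w :+ (:- w :+ u :* (con 0ℚ :+ u :* (con 0ℚ :+ u :*
          (con 0ℚ :+ u :* (con 0ℚ :+ u :* (con 1ℚ :+ u :* con 0ℚ)))))) :* con 1ℚ) ≈-refl u w)

        u*v≈A : u * v ≈ A
        u*v≈A = begin
          u * v                   ≈⟨ solve 3 (λ u w B → u :* (u :^ 4 :* w :* B :^ 4) := (u :^ 5 :* w) :* B :^ 4) ≈-refl u w′ B ⟩
          (u ^ 5 * w′) * B ^ 4    ≈⟨ *-congʳ (*-congʳ u⁵≈w) ⟩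
          (w * w′) * B ^ 4        ≈⟨ *-congʳ w*w′≈A⁵ ⟩
          A ^ 5 * B ^ 4           ≈⟨ solve 2 (λ A B → A :^ 5 :* B :^ 4 := A :* (A :* B) :^ 4) ≈-refl A B ⟩
          A * (A * B) ^ 4         ≈⟨ *-congˡ ([A*B]^n≈1 4) ⟩
          A * 1#                  ≈⟨ *-identityʳ A ⟩
          A                       ∎

        -- Both u⁵v⁵ and u⁵w′ equal A⁵, but u⁵ is not known to be invertible at this point. Instead
        -- v⁵ is multiplied by (AB)⁵ = 1 and A⁵ is rewritten as u⁵w′, which makes (uvB)⁵ = (AB)⁵ = 1
        -- appear beside w′.
        v⁵≈w′ : v ^ 5 ≈ w′
        v⁵≈w′ = begin
          v ^ 5                        ≈⟨ *-identityʳ _ ⟨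
          v ^ 5 * 1#                   ≈⟨ *-congˡ ([A*B]^n≈1 5) ⟨
          v ^ 5 * (A * B) ^ 5          ≈⟨ solve 3 (λ v A B → v :^ 5 :* (A :* B) :^ 5 := A :^ 5 :* (v :* B) :^ 5) ≈-refl v A B ⟩
          A ^ 5 * (v * B) ^ 5          ≈⟨ *-congʳ w*w′≈A⁵ ⟨
          (w * w′) * (v * B) ^ 5       ≈⟨ *-congʳ (*-congʳ u⁵≈w) ⟨
          (u ^ 5 * w′) * (v * B) ^ 5   ≈⟨ solve 4 (λ u v w B → (u :^ 5 :* w) :* (v :* B) :^ 5 := w :* ((u :* v) :* B) :^ 5) ≈-refl u v w′ B ⟩
          w′ * ((u * v) * B) ^ 5       ≈⟨ *-congˡ (^-cong 5 (*-congʳ u*v≈A)) ⟩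
          w′ * (A * B) ^ 5             ≈⟨ *-congˡ ([A*B]^n≈1 5) ⟩
          w′ * 1#                      ≈⟨ *-identityʳ w′ ⟩
          w′                           ∎

        target≈ : map ι (dickson a e) ≈ᴾ target (u + v) (u * v)
        target≈ 0 = begin
          E
            ≈⟨ solve 1 (λ E → E := :- (:- E)) ≈-refl E ⟩
          - (- E)
            ≈⟨ -‿cong w+w′≈-E ⟨
          - (w + w′)
            ≈⟨ -‿cong (+-cong u⁵≈w v⁵≈w′) ⟨
          - (u ^ 5 + v ^ 5)
            ≈⟨ solve 2 (λ u v → :- (u :^ 5 :+ v :^ 5) := :- ((u :+ v) :^ 5 :- nat′ 5 :* ((u :* v) :* (u :+ v) :^ 3)
                 :+ nat′ 5 :* ((u :* v) :^ 2 :* (u :+ v)))) ≈-refl u v ⟩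
          _ ∎
        target≈ 1 = begin
          ι (fromℤ (+ 5) ℚ.* (a ℚ.* a))  ≈⟨ *-homo _ _ ⟩
          nat 5 * ι (a ℚ.* a)            ≈⟨ *-congˡ (*-homo a a) ⟩
          nat 5 * (A * A)                ≈⟨ *-congˡ (*-cong u*v≈A u*v≈A) ⟨
          nat 5 * ((u * v) * (u * v))    ∎
        target≈ 2 = 0#-homo
        target≈ 3 = begin
          ι (ℚ.- (fromℤ (+ 5) ℚ.* a))    ≈⟨ -‿homo _ ⟩
          - ι (fromℤ (+ 5) ℚ.* a)        ≈⟨ -‿cong (*-homo _ a) ⟩
          - (nat 5 * A)                  ≈⟨ -‿cong (*-congˡ u*v≈A) ⟨
          - (nat 5 * (u * v))            ∎
        target≈ 4 = 0#-homo
        target≈ 5 = 1#-homo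
        target≈ (suc (suc (suc (suc (suc (suc n)))))) = ≈-refl

        module _ (ζ : Carrier) (Φ₅ : eval (1# ∷ 1# ∷ 1# ∷ 1# ∷ 1# ∷ []) ζ ≈ 0#) where

          private
            K₁ K₂ K₃ : Pred Carrier 0ℓ
            K₁ = Rationals ⟨ r ⟩
            K₂ = K₁ ⟨ u ⟩
            K₃ = K₂ ⟨ ζ ⟩

            r²∈ : Rationals (r ^ 2)
            r²∈ with Rationals-+ (Rationals-* (Rationals-ι e) (Rationals-ι e))
                       (Rationals-neg (Rationals-* (Rationals-ι (fromℤ (+ 4))) (Rationals-^ (Rationals-ι a) 5)))
            ... | q , q≈D = q , trans q≈D (sym r²≈D)

            u⁵∈ : K₁ (u ^ 5)
            u⁵∈ = resp (sym u⁵≈w) (mul (base (Rationals-ι ℚ.½)) (add gen (neg (base (Rationals-ι e)))))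

            ζ⁵∈ : K₂ (ζ ^ 5)
            ζ⁵∈ = resp (sym (ζ⁵≈1 ζ Φ₅ u v)) (base (base Rationals-1#))

            u∈ : K₃ u
            u∈ = base gen

            v∈ : K₃ v
            v∈ = base (mul (mul (⟨⟩-^ (base Rationals-1#) gen 4)
                                (base (mul (base (Rationals-ι ℚ.½)) (add (neg (base (Rationals-ι e))) (neg gen)))))
                           (base (base (Rationals-^ (Rationals-ι (ℚ.1/ a)) 4))))

            ζ^∈ : ∀ n → K₃ (ζ ^ n)
            ζ^∈ = ⟨⟩-^ (base (base Rationals-1#)) gen

          splits : ∃[ K ] (RadicalExtension K × SplitsOver K (map ι (dickson a e)))
          splits = K₃ , adjoin (adjoin (adjoin rationals r 2 r²∈) u 5 u⁵∈) ζ 5 ζ⁵∈ ,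
            1# , roots ζ Φ₅ u v ,
            base (base (base Rationals-1#)) ∷
            add (mul gen u∈) (mul (ζ^∈ 4) v∈) ∷ add (mul (ζ^∈ 4) u∈) (mul gen v∈) ∷
            add (mul (ζ^∈ 2) u∈) (mul (ζ^∈ 3) v∈) ∷ add (mul (ζ^∈ 3) u∈) (mul (ζ^∈ 2) v∈) ∷
            add u∈ v∈ ∷ [] ,
            λ n → trans (target≈ n) (sym (product-roots ζ Φ₅ u v n))

    dickson-splits : ∃[ K ] (RadicalExtension K × SplitsOver K (map ι (dickson a e)))
    dickson-splits
      with r , hr ← closed (- D) (0# ∷ [])
      with u , hu ← closed (- (ι ℚ.½ * (r - E))) (0# ∷ 0# ∷ 0# ∷ 0# ∷ [])
      -- A root of 1 + X + X² + X³ + X⁴ rather than of X⁵ - 1, for which `closed` might return 1.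
      with ζ , hζ ← closed 1# (1# ∷ 1# ∷ 1# ∷ []) =
      Roots.splits r hr u hu ζ hζ

dickson-solvable : ∀ a e → a ≢ 0ℚ → SolvableByRadicals (dickson a e)
dickson-solvable a e a≢0 Ω = DicksonSplitting.dickson-splits Ω a e a≢0

-- The family of integral quintics

fromℕ : ℕ → ℚ
fromℕ n = fromℤ (+ n)

fromℕ-mono-≤ : ∀ {m n} → m ℕ.≤ n → fromℕ m ≤ fromℕ n
fromℕ-mono-≤ m≤n = fromℤ-mono-≤ (+≤+ m≤n)

fromℕ-* : ∀ m n → fromℕ (m ℕ.* n) ≡ fromℕ m ℚ.* fromℕ n
fromℕ-* m n = ≡.trans (cong fromℤ (ℤ.pos-* m n)) (fromℤ-* (+ m) (+ n))

dicksonℤ : ℕ → ℕ → Vec ℤ 5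
dicksonℤ a e = 0ℤ ∷ ℤ.- (+ (5 ℕ.* a)) ∷ 0ℤ ∷ + (5 ℕ.* (a ℕ.* a)) ∷ + e ∷ []

quintic-dicksonℤ : ∀ a e → quintic (dicksonℤ a e) ≡ dickson (fromℕ a) (fromℕ e)
quintic-dicksonℤ a e = cong₂ (λ x y → fromℕ e ∷ x ∷ 0ℚ ∷ y ∷ 0ℚ ∷ 1ℚ ∷ [])
  (≡.trans (fromℕ-* 5 (a ℕ.* a)) (cong (fromℕ 5 ℚ.*_) (fromℕ-* a a)))
  (≡.trans (fromℤ-neg (+ (5 ℕ.* a))) (cong ℚ.-_ (fromℕ-* 5 a)))

dicksonℤ-irreducible : ∀ a k → Irreducible (quintic (dicksonℤ a (25 ℕ.* k ℕ.+ 5)))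
dicksonℤ-irreducible a k = eisenstein (from-yes (prime? 5)) F 5 z<s
  (λ { (suc (suc (suc (suc (suc (suc k)))))) _ → refl ; 0 () ; 1 (s≤s ()) ; 2 (s≤s (s≤s ())) ; 3 (s≤s (s≤s (s≤s ())))
     ; 4 (s≤s (s≤s (s≤s (s≤s ())))) ; 5 (s≤s (s≤s (s≤s (s≤s (s≤s ()))))) })
  (λ d → from-no (5 ℕ.∣? 1) (∣⇒∣ᵤ d))
  (λ { 0 _ → ∣ᵤ⇒∣ 5∣e
     ; 1 _ → ∣ᵤ⇒∣ (ℕ.m∣m*n (a ℕ.* a))
     ; 2 _ → divides 0ℤ refl
     ; 3 _ → ∣ᵤ⇒∣ (subst (5 ℕ.∣_) (≡.sym (ℤ.∣-i∣≡∣i∣ (+ (5 ℕ.* a)))) (ℕ.m∣m*n a))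
     ; 4 _ → divides 0ℤ refl
     ; (suc (suc (suc (suc (suc _))))) (s≤s (s≤s (s≤s (s≤s (s≤s ()))))) })
  -- The stride 25 keeps the constant term congruent to 5 modulo 25.
  (λ d → from-no (25 ℕ.∣? 5) (ℕ.∣m+n∣m⇒∣n (∣⇒∣ᵤ d) (ℕ.m∣m*n k)))
  where
  F : List ℤ
  F = + (25 ℕ.* k ℕ.+ 5) ∷ + (5 ℕ.* (a ℕ.* a)) ∷ 0ℤ ∷ ℤ.- (+ (5 ℕ.* a)) ∷ 0ℤ ∷ 1ℤ ∷ []

  5∣e : 5 ℕ.∣ 25 ℕ.* k ℕ.+ 5
  5∣e = ℕ.∣m∣n⇒∣m+n (ℕ.∣m⇒∣m*n k (ℕ.m∣m*n 5)) ℕ.∣-refl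

dicksonℤ-solvable : ∀ a e → SolvableByRadicals (quintic (dicksonℤ (suc a) e))
dicksonℤ-solvable a e = subst SolvableByRadicals (≡.sym (quintic-dicksonℤ (suc a) e))
  (dickson-solvable (fromℕ (suc a)) (fromℕ e) λ eq → case fromℤ-injective {+ suc a} {0ℤ} eq of λ ())

∈[-,+] : ∀ {H} i b → ℤ.∣ i ∣ ℕ.≤ b → fromℕ b ≤ H → i ∈[- H ,+]
∈[-,+] {H} i b ∣i∣≤b b≤H =
    ℚ.≤-trans (ℚ.neg-antimono-≤ b≤H) (subst (_≤ fromℤ i) (fromℤ-neg (+ b)) (fromℤ-mono-≤ (lower i ∣i∣≤b)))
  , ℚ.≤-trans (fromℤ-mono-≤ (upper i ∣i∣≤b)) b≤H
  where
  upper : ∀ i → ℤ.∣ i ∣ ℕ.≤ b → i ℤ.≤ + b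
  upper (+ n)      n≤b = +≤+ n≤b
  upper ℤ.-[1+ n ] n≤b = ℤ.-≤+

  lower : ∀ i → ℤ.∣ i ∣ ℕ.≤ b → ℤ.- + b ℤ.≤ i
  lower (+ n)      n≤b = ℤ.≤-trans (ℤ.neg-mono-≤ (+≤+ z≤n)) (+≤+ z≤n)
  lower ℤ.-[1+ n ] n≤b = ℤ.neg-mono-≤ (+≤+ n≤b)

-- The index `a` starts at 0 to match `Fin`, while the Dickson parameter `suc a` stays nonzero, as
-- the construction of `v` demands.
member : ℕ → ℕ → Vec ℤ 5
member a k = dicksonℤ (suc a) (25 ℕ.* k ℕ.+ 5)

member-injective : ∀ a k a′ k′ → member a k ≡ member a′ k′ → a ≡ a′ × k ≡ k′
member-injective a k a′ k′ eq =
    ℕ.suc-injective (ℕ.*-cancelˡ-≡ (suc a) (suc a′) 5 (ℤ.+-injective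
      (ℤ.neg-injective (cong (λ { (_ ∷ b ∷ _) → b }) eq))))
  , ℕ.*-cancelˡ-≡ k k′ 25 (ℕ.+-cancelʳ-≡ 5 _ _ (ℤ.+-injective
      (cong (λ { (_ ∷ _ ∷ _ ∷ _ ∷ e ∷ []) → e }) eq)))

member-bounded : ∀ {H} m a k → a ℕ.< m → k ℕ.< m ℕ.* m → fromℕ (25 ℕ.* (m ℕ.* m)) ≤ H →
                 Vec.All (_∈[- H ,+]) (member a k)
member-bounded m@(suc _) a k a<m k<m² h =
  within 0ℤ z≤n ∷
  within (ℤ.- (+ (5 ℕ.* suc a))) (ℕ.*-mono-≤ (ℕ.m≤m+n 5 20) (ℕ.≤-trans a<m (ℕ.m≤m*n m m))) ∷
  within 0ℤ z≤n ∷
  within (+ (5 ℕ.* (suc a ℕ.* suc a))) (ℕ.*-mono-≤ (ℕ.m≤m+n 5 20) (ℕ.*-mono-≤ a<m a<m)) ∷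
  within (+ (25 ℕ.* k ℕ.+ 5)) 25k+5≤25m² ∷ []
  where
  within : ∀ i → ℤ.∣ i ∣ ℕ.≤ 25 ℕ.* (m ℕ.* m) → i ∈[- _ ,+]
  within i i≤ = ∈[-,+] i (25 ℕ.* (m ℕ.* m)) i≤ h

  open ℕ.≤-Reasoning
  -- This coefficient dictates the height `25m²`; the others are at most `5m²` in absolute value.
  25k+5≤25m² : 25 ℕ.* k ℕ.+ 5 ℕ.≤ 25 ℕ.* (m ℕ.* m)
  25k+5≤25m² = begin
    25 ℕ.* k ℕ.+ 5     ≤⟨ ℕ.+-monoʳ-≤ (25 ℕ.* k) (ℕ.m≤m+n 5 20) ⟩
    25 ℕ.* k ℕ.+ 25    ≡⟨ ℕ.+-comm (25 ℕ.* k) 25 ⟩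
    25 ℕ.+ 25 ℕ.* k    ≡⟨ ℕ.*-suc 25 k ⟨
    25 ℕ.* suc k       ≤⟨ ℕ.*-monoʳ-≤ 25 k<m² ⟩
    25 ℕ.* (m ℕ.* m)   ∎

member-∈ : ∀ {H} m a k → a ℕ.< m → k ℕ.< m ℕ.* m → fromℕ (25 ℕ.* (m ℕ.* m)) ≤ H →
           SolvableQuintics H (member a k)
member-∈ m a k a<m k<m² h =
  member-bounded m a k a<m k<m² h , dicksonℤ-irreducible (suc a) k , dicksonℤ-solvable a (25 ℕ.* k ℕ.+ 5)

m³≤∣SolvableQuintics∣ : ∀ {H} m → fromℕ (25 ℕ.* (m ℕ.* m)) ≤ H →
                        m ℕ.* (m ℕ.* m) ≤∣ SolvableQuintics H ∣
m³≤∣SolvableQuintics∣ {H} m h = f , f-injective , λ i →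
    member-∈ m (a i) (k i) (Fin.toℕ<n (proj₁ (pair i))) (Fin.toℕ<n (proj₂ (pair i))) h
  where
  pair : Fin (m ℕ.* (m ℕ.* m)) → Fin m × Fin (m ℕ.* m)
  pair = remQuot {m} (m ℕ.* m)

  a k : Fin (m ℕ.* (m ℕ.* m)) → ℕ
  a i = toℕ (proj₁ (pair i))
  k i = toℕ (proj₂ (pair i))

  f : Fin (m ℕ.* (m ℕ.* m)) → Vec ℤ 5
  f i = member (a i) (k i)

  f-injective : Injective _≡_ _≡_ f
  f-injective {i} {j} eq = let a≡ , k≡ = member-injective (a i) (k i) (a j) (k j) eq in begin
    i                                               ≡⟨ Fin.combine-remQuot {m} (m ℕ.* m) i ⟨
    combine (proj₁ (pair i)) (proj₂ (pair i))       ≡⟨ cong₂ combine (Fin.toℕ-injective a≡) (Fin.toℕ-injective k≡) ⟩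
    combine (proj₁ (pair j)) (proj₂ (pair j))       ≡⟨ Fin.combine-remQuot {m} (m ℕ.* m) j ⟩
    j                                               ∎
    where open ≡.≡-Reasoning

-- The choice of m and the constant

-- An explicit Archimedean bound: the denominator is at least 1.
≤fromℕ∣↥∣ : ∀ H → H ≤ fromℕ ℤ.∣ ℚ.↥ H ∣
≤fromℕ∣↥∣ H@(mkℚ i d-1 _) = subst (H ≤_) (≡.sym (fromℤ-mkℚ (+ ℤ.∣ i ∣))) (*≤* (bound i))
  where
  bound : ∀ i → i ℤ.* + 1 ℤ.≤ + ℤ.∣ i ∣ ℤ.* + suc d-1
  bound (+ n)      = ℤ.*-monoˡ-≤-nonNeg (+ n) {+ 1} {+ suc d-1} (+≤+ (s≤s z≤n))
  bound ℤ.-[1+ n ] = -≤+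

-- A search downwards from `n` by the decidable order of ℚ, stopped at 1 at the latest. For b(m) =
-- 25m² it finds the integer part of √(H/25) without square roots.
straddle : ∀ (b : ℕ → ℚ) H → b 1 ≤ H → ∀ n → H < b (suc n) →
           ∃[ m ] (1 ℕ.≤ m × b m ≤ H × H < b (suc m))
straddle b H b₁≤H zero    H<b₁ = contradiction (ℚ.≤-<-trans b₁≤H H<b₁) (ℚ.<-irrefl refl)
straddle b H b₁≤H (suc n) H<   with b (suc n) ℚ.≤? H
... | yes ≤H = suc n , s≤s z≤n , ≤H , H<
... | no  ≰H = straddle b H b₁≤H n (ℚ.≰⇒> ≰H)

straddle-25m² : ∀ H → fromℕ 25 ≤ H →
                ∃[ m ] (1 ℕ.≤ m × fromℕ (25 ℕ.* (m ℕ.* m)) ≤ H × H < fromℕ (25 ℕ.* (suc m ℕ.* suc m)))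
straddle-25m² H 25≤H = straddle (λ m → fromℕ (25 ℕ.* (m ℕ.* m))) H 25≤H ℤ.∣ ℚ.↥ H ∣
  (ℚ.≤-<-trans (≤fromℕ∣↥∣ H) (fromℤ-mono-< (+<+ (big ℤ.∣ ℚ.↥ H ∣))))
  where
  big : ∀ n → n ℕ.< 25 ℕ.* (suc n ℕ.* suc n)
  big n = ℕ.≤-trans (ℕ.m≤m*n (suc n) (suc n)) (ℕ.m≤n*m (suc n ℕ.* suc n) 25)

*-mono-≤-nonNeg : ∀ {x y z w} → 0ℚ ≤ y → 0ℚ ≤ z → x ≤ y → z ≤ w → x ℚ.* z ≤ y ℚ.* w
*-mono-≤-nonNeg {x} {y} {z} {w} 0≤y 0≤z x≤y z≤w =
  ℚ.≤-trans (ℚ.*-monoʳ-≤-nonNeg z {{ℚ.nonNegative 0≤z}} x≤y)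
            (ℚ.*-monoˡ-≤-nonNeg y {{ℚ.nonNegative 0≤y}} z≤w)

corollary1p6 :
  ∃[ c ] (0ℚ < c × (∃[ H₀ ] ((H : ℚ) → H₀ ≤ H →
    ∃[ n ] ((n ≤∣ SolvableQuintics H ∣) × (c · H ^3/2≤ n)))))
-- H₀ = 25 is where m = 1 becomes admissible, and m ≥ 1 is what yields m + 1 ≤ 2m, hence 25(m + 1)²
-- ≤ 100m².
corollary1p6 = c , ℚ.positive⁻¹ c , fromℕ 25 , λ H 25≤H → case straddle-25m² H 25≤H of λ where
    (m , 1≤m , 25m²≤H , H<25[m+1]²) →
      m ℕ.* (m ℕ.* m) , m³≤∣SolvableQuintics∣ m 25m²≤H , bound H m 25≤H 1≤m (ℚ.<⇒≤ H<25[m+1]²)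
  where
  -- H < 25(m + 1)² ≤ 100m², so H³ ≤ 10⁶m⁶ = 1000²n² for n = m³.
  c : ℚ
  c = + 1 ℚ./ 1000

  bound : ∀ H m → fromℕ 25 ≤ H → 1 ℕ.≤ m → H ≤ fromℕ (25 ℕ.* (suc m ℕ.* suc m)) →
          c · H ^3/2≤ (m ℕ.* (m ℕ.* m))
  bound H m 25≤H 1≤m H≤ = begin
    (c ℚ.* c) ℚ.* (H ℚ.* H ℚ.* H)    ≤⟨ ℚ.*-monoˡ-≤-nonNeg (c ℚ.* c)
                                          (*-mono-≤-nonNeg (ℚ.≤-trans 0≤H² H²≤K²) 0≤H H²≤K² H≤K) ⟩
    (c ℚ.* c) ℚ.* (K ℚ.* K ℚ.* K)    ≡⟨ solve 1 (λ M → (con c :* con c) :*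
                                          (con (fromℕ 100) :* (M :* M) :* (con (fromℕ 100) :* (M :* M)) :* (con (fromℕ 100) :* (M :* M)))
                                          := (M :* (M :* M)) :* (M :* (M :* M))) refl M ⟩
    (M ℚ.* (M ℚ.* M)) ℚ.* (M ℚ.* (M ℚ.* M))
                                     ≡⟨ cong (λ x → x ℚ.* x) M³≡ ⟨
    fromℕ (m ℕ.* (m ℕ.* m)) ℚ.* fromℕ (m ℕ.* (m ℕ.* m))  ∎
    where
    open ℚ.≤-Reasoning
    open ℚ.+-*-Solver

    M K : ℚ
    M = fromℕ m
    K = fromℕ 100 ℚ.* (M ℚ.* M)

    M³≡ : fromℕ (m ℕ.* (m ℕ.* m)) ≡ M ℚ.* (M ℚ.* M)
    M³≡ = ≡.trans (fromℕ-* m (m ℕ.* m)) (cong (M ℚ.*_) (fromℕ-* m m))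

    0≤H : 0ℚ ≤ H
    0≤H = ℚ.≤-trans (fromℕ-mono-≤ {0} {25} z≤n) 25≤H

    25[m+1]²≤100m² : 25 ℕ.* (suc m ℕ.* suc m) ℕ.≤ 100 ℕ.* (m ℕ.* m)
    25[m+1]²≤100m² = ℕ.≤-trans (ℕ.*-monoʳ-≤ 25 (ℕ.*-mono-≤ m+1≤2m m+1≤2m))
      (ℕ.≤-reflexive (ℕ.+-*-Solver.solve 1 (λ m → con′ 25 :*′ ((m :+′ m) :*′ (m :+′ m)) :=′ con′ 100 :*′ (m :*′ m)) refl m))
      where
      open ℕ.+-*-Solver using () renaming (con to con′; _:*_ to _:*′_; _:+_ to _:+′_; _:=_ to _:=′_)
      m+1≤2m : suc m ℕ.≤ m ℕ.+ m
      m+1≤2m = ℕ.+-monoˡ-≤ m 1≤m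

    H≤K : H ≤ K
    H≤K = ℚ.≤-trans H≤ (subst (fromℕ (25 ℕ.* (suc m ℕ.* suc m)) ≤_)
      (≡.trans (fromℕ-* 100 (m ℕ.* m)) (cong (fromℕ 100 ℚ.*_) (fromℕ-* m m)))
      (fromℕ-mono-≤ 25[m+1]²≤100m²))

    0≤H² : 0ℚ ≤ H ℚ.* H
    0≤H² = ℚ.≤-trans (ℚ.≤-reflexive (≡.sym (ℚ.*-zeroʳ H))) (ℚ.*-monoˡ-≤-nonNeg H {{ℚ.nonNegative 0≤H}} 0≤H)

    H²≤K² : H ℚ.* H ≤ K ℚ.* K
    H²≤K² = *-mono-≤-nonNeg (ℚ.≤-trans 0≤H H≤K) 0≤H H≤K H≤K
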